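{- Let $\tau$ be a counterclockwise permutation for monotone non-identical linear functions $f_1,\dots,f_n$. Then the cyclic sequence $(f^{\tau_0},\dots,f^{\tau_{n-1}})$ is strictly unimodal. Moreover, if $f_1,\dots,f_n$ are neither colinear nor potentially identical, then for every $k\in\{0,\dots,n-1\}$ (indices mod $n$, with $\tau_n=\tau_0$), $f^{\tau_k}=f^{\tau_{k+1}}$ implies exactly one of: (i) $f^{\tau_k}=f^{\tau_{k+1}}=\min_{0\le i<n}f^{\tau_i}$ and $\theta(f_{\tau(k+1)})+\pi=_{2\pi}\theta(f^{\tau_k})$; (ii) $f^{\tau_k}=f^{\tau_{k+1}}=\max_{0\le i<n}f^{\tau_i}$ and $\theta(f_{\tau(k+1)})=_{2\pi}\theta(f^{\tau_k})$.
   Context: A linear function is $f(x)=ax+b$; monotone means $a>0$; identical means $f(x)=x$. $\vec f=(b,1-a)^\top$ and $\theta(f)\in[0,2\pi)$ is its polar angle ($\bot$ if $\vec f=0$); $\theta_1=_{2\pi}\theta_2$ means $\theta_1-\theta_2\in2\pi\mathbb{Z}$. For a permutation $\sigma$ of $[n]$, $f^\sigma=f_{\sigma(n)}\circ\cdots\circ f_{\sigma(1)}$; these composites are totally ordered pointwise. $\sigma$ is counterclockwise if, after discarding positions with identical $f_{\sigma(i)}$, there is $k$ with $\theta(f_{\sigma(k)})\le\cdots\le\theta(f_{\sigma(n)})\le\theta(f_{\sigma(1)})\le\cdots\le\theta(f_{\sigma(k-1)})$. $f_1,\dots,f_n$ are colinear if some $\lambda$ satisfies $\theta(f_i)\in\{\lambda,\lambda+\pi\}+2\pi\mathbb{Z}$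 or $\theta(f_i)=\bot$ for all $i$, and potentially identical if $f^\sigma(x)=x$ for some counterclockwise $\sigma$. The $k$-shift is $\tau_k(i)=\tau(i+k)$ for $i\le n-k$, $\tau_k(i)=\tau(i+k-n)$ otherwise. A cyclic sequence $(x_0,\dots,x_{n-1})$ is unimodal if there are $k,\ell$ with $x_k\le x_{k+1}\le\cdots\le x_\ell\ge x_{\ell+1}\ge\cdots\ge x_{k-1}\ge x_k$ (indices mod $n$); it is strictly unimodal if it is unimodal and whenever $x_j=x_{j+1}$ this common value is the minimum or the maximum of the sequence. -}

module Defs where

open import Level using (Level; _⊔_) renaming (suc to lsuc)
open import Data.Nat.Base as ℕ using (ℕ; suc; NonZero)
open import Data.Nat.DivMod using (_mod_)
open import Data.Integer.Base using (ℤ; +_; -[1+_])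
open import Data.Fin.Base using (Fin; toℕ)
open import Data.Fin.Permutation using (Permutation′; _⟨$⟩ʳ_)
open import Data.List.Base using (List; mapMaybe; allFin; take; drop; _++_)
open import Data.List.Relation.Unary.Linked using (Linked)
open import Data.Maybe.Base as Maybe using (Maybe; just; nothing)
open import Data.Maybe.Relation.Binary.Pointwise using (Pointwise)
open import Data.Product.Base using (Σ; ∃; ∃-syntax; _×_; _,_; proj₁)
open import Data.Sum.Base using (_⊎_)
import Data.Vec.Functional as Vector
open import Relation.Binary.Core using (Rel)
open import Relation.Binary.Structures using (IsDecTotalOrder)
open import Relation.Binary.PropositionalEquality.Core using (_≡_)
open import Relation.Nullary.Decidable.Core using (Dec; yes; no; _×-dec_)
open import Relation.Nullary.Negation.Core using (¬_)
open import Relation.Unary using (Pred)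
open import Algebra.Bundles using (CommutativeRing)
import Algebra.Definitions.RawMonoid as RawMonoidDefs
import Relation.Binary.Reasoning.Setoid as SetoidReasoning

-- The (classical) real numbers: a Dedekind-complete ordered field.  Any two
-- such structures are isomorphic, so quantifying over them is speaking of ℝ.
record Reals (c ℓ : Level) : Set (lsuc (c ⊔ ℓ)) where
  field
    commutativeRing : CommutativeRing c ℓ

  open CommutativeRing commutativeRing public

  infix 4 _≤_ _<_

  field
    _≤_             : Rel Carrier ℓ
    isDecTotalOrder : IsDecTotalOrder _≈_ _≤_

  _<_ : Rel Carrier ℓ
  x < y = x ≤ y × ¬ (x ≈ y)

  IsUpperBound : Pred Carrier ℓ → Carrier → Set (c ⊔ ℓ)
  IsUpperBound P u = ∀ x → P x → x ≤ u

  field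
    0<1      : 0# < 1#
    inverse  : ∀ x → ¬ (x ≈ 0#) → ∃[ y ] x * y ≈ 1#
    +-mono-≤ : ∀ {x y} z → x ≤ y → x + z ≤ y + z
    *-nonneg : ∀ {x y} → 0# ≤ x → 0# ≤ y → 0# ≤ x * y
    complete : ∀ (P : Pred Carrier ℓ) → ∃ P → ∃ (IsUpperBound P) →
               ∃[ s ] IsUpperBound P s × (∀ u → IsUpperBound P u → s ≤ u)

  open IsDecTotalOrder isDecTotalOrder public using (_≟_; _≤?_)

  infixr 8 _·_

  _·_ : ℤ → Carrier → Carrier
  (+ n)    · x = RawMonoidDefs._×_ +-rawMonoid n x
  -[1+ n ] · x = - RawMonoidDefs._×_ +-rawMonoid (suc n) x

-- Sine, cosine and π, by the axioms of Apostol (Calculus I, §2.5), which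
-- determine them uniquely over ℝ.  The last of these axioms,
-- 0 < cos x < sin x / x < 1 / cos x on (0 , π/2), is stated without division.
record Trigonometry {c ℓ} (R : Reals c ℓ) : Set (c ⊔ ℓ) where
  open Reals R
  field
    cos sin  : Carrier → Carrier
    ½π       : Carrier
    cos-cong : ∀ {x y} → x ≈ y → cos x ≈ cos y
    sin-cong : ∀ {x y} → x ≈ y → sin x ≈ sin y

  π : Carrier
  π = ½π + ½π

  2π : Carrier
  2π = π + π

  field
    0<½π        : 0# < ½π
    cos-0       : cos 0# ≈ 1#
    sin-½π      : sin ½π ≈ 1#
    cos-π       : cos π ≈ - 1#
    cos-sub     : ∀ x y → cos (y - x) ≈ cos y * cos x + sin y * sin x
    cos-pos     : ∀ {x} → 0# < x → x < ½π → 0# < cos x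
    x*cos<sin   : ∀ {x} → 0# < x → x < ½π → x * cos x < sin x
    sin*cos<x   : ∀ {x} → 0# < x → x < ½π → sin x * cos x < x

  IsPolarAngle : Carrier → Carrier → Carrier → Set (c ⊔ ℓ)
  IsPolarAngle x y t =
    0# ≤ t × t < 2π × ∃[ r ] 0# < r × x ≈ r * cos t × y ≈ r * sin t

  -- Existence of polar coordinates.  It follows from the axioms above; it is
  -- a field so that the polar angle is available as a function.
  field
    polar : ∀ x y → ¬ (x ≈ 0# × y ≈ 0#) → ∃ (IsPolarAngle x y)

module CyclicSequence {a ℓ₁ ℓ₂} {A : Set a} (_≈_ : Rel A ℓ₁) (_≤_ : Rel A ℓ₂)
                      {n : ℕ} .{{_ : NonZero n}} (x : Fin n → A) where

  at : ℕ → A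
  at j = x (j mod n)

  -- x_k ≤ ⋯ ≤ x_ℓ ≥ ⋯ ≥ x_k : the position ℓ is counted from k onwards, and
  -- the cycle closes at position k + n.
  Unimodal : Set ℓ₂
  Unimodal = ∃[ k ] ∃[ l ] k ℕ.≤ l × l ℕ.≤ k ℕ.+ n
    × (∀ j → k ℕ.≤ j → j ℕ.< l → at j ≤ at (suc j))
    × (∀ j → l ℕ.≤ j → j ℕ.< k ℕ.+ n → at (suc j) ≤ at j)

  IsMinimum IsMaximum : A → Set (ℓ₁ ⊔ ℓ₂)
  IsMinimum v = (∃[ i ] v ≈ x i) × (∀ i → v ≤ x i)
  IsMaximum v = (∃[ i ] v ≈ x i) × (∀ i → x i ≤ v)

  StrictlyUnimodal : Set (ℓ₁ ⊔ ℓ₂)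
  StrictlyUnimodal = Unimodal
    × (∀ (j : Fin n) → x j ≈ at (suc (toℕ j)) → IsMinimum (x j) ⊎ IsMaximum (x j))

-- τ_k; with positions 0, …, n-1 instead of 1, …, n, it sends i to
-- τ(i + k mod n).
shift : ∀ {n} .{{_ : NonZero n}} → ℕ → Permutation′ n → Fin n → Fin n
shift {n} k τ i = τ ⟨$⟩ʳ ((toℕ i ℕ.+ k) mod n)

module LinearFunctions {c ℓ} (R : Reals c ℓ) (T : Trigonometry R) where
  open Reals R
  open Trigonometry T

  record Linear : Set c where
    constructor _x+_
    field
      slope intercept : Carrier

  open Linear public

  ⟦_⟧ : Linear → Carrier → Carrier
  ⟦ f ⟧ x = slope f * x + intercept f

  infix 4 _≈ᴸ_ _≤ᴸ_

  _≈ᴸ_ _≤ᴸ_ : Rel Linear (c ⊔ ℓ)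
  f ≈ᴸ g = ∀ x → ⟦ f ⟧ x ≈ ⟦ g ⟧ x
  f ≤ᴸ g = ∀ x → ⟦ f ⟧ x ≤ ⟦ g ⟧ x

  Monotone : Linear → Set ℓ
  Monotone f = 0# < slope f

  Identical : Linear → Set (c ⊔ ℓ)
  Identical f = ∀ x → ⟦ f ⟧ x ≈ x

  idᴸ : Linear
  idᴸ = 1# x+ 0#

  infixr 9 _∘ᴸ_

  _∘ᴸ_ : Linear → Linear → Linear
  g ∘ᴸ f = (slope g * slope f) x+ (slope g * intercept f + intercept g)

  ∘ᴸ-correct : ∀ g f x → ⟦ g ∘ᴸ f ⟧ x ≈ ⟦ g ⟧ (⟦ f ⟧ x)
  ∘ᴸ-correct (a x+ b) (a′ x+ b′) x = begin
    (a * a′) * x + (a * b′ + b)  ≈⟨ +-assoc _ _ _ ⟨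
    ((a * a′) * x + a * b′) + b  ≈⟨ +-congʳ (+-congʳ (*-assoc _ _ _)) ⟩
    (a * (a′ * x) + a * b′) + b  ≈⟨ +-congʳ (distribˡ _ _ _) ⟨
    a * (a′ * x + b′) + b        ∎
    where open SetoidReasoning setoid

  -- f ^ σ = f_{σ(n)} ∘ ⋯ ∘ f_{σ(1)}
  infixr 8 _^_

  _^_ : ∀ {n} → (Fin n → Linear) → (Fin n → Fin n) → Linear
  f ^ σ = Vector.foldl (λ g h → h ∘ᴸ g) idᴸ (λ i → f (σ i))

  -- The polar angle of (b , 1 - a), with nothing for ⊥.
  θ : Linear → Maybe Carrier
  θ (a x+ b) with (b ≟ 0#) ×-dec ((1# - a) ≟ 0#)
  ... | yes _   = nothing
  ... | no  v≉0 = just (proj₁ (polar b (1# - a) v≉0))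

  _≈[2π]_ : Rel Carrier ℓ
  s ≈[2π] t = ∃[ m ] s - t ≈ m · 2π

  _=[2π]_ : Rel (Maybe Carrier) (c ⊔ ℓ)
  _=[2π]_ = Pointwise _≈[2π]_

  _+π : Maybe Carrier → Maybe Carrier
  s +π = Maybe.map (_+ π) s

  module _ {n : ℕ} (f : Fin n → Linear) where

    -- θ(f_{σ(1)}), …, θ(f_{σ(n)}) without the entries ⊥, that is, after
    -- discarding the positions i with f_{σ(i)} identical.
    angles : Permutation′ n → List Carrier
    angles σ = mapMaybe (λ i → θ (f (σ ⟨$⟩ʳ i))) (allFin n)

    Counterclockwise : Permutation′ n → Set (c ⊔ ℓ)
    Counterclockwise σ = ∃[ k ] Linked _≤_ (drop k (angles σ) ++ take k (angles σ))

    Colinear : Set (c ⊔ ℓ)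
    Colinear = ∃[ t ] ∀ i →
      θ (f i) =[2π] just t ⊎ θ (f i) =[2π] just (t + π) ⊎ θ (f i) ≡ nothing

    PotentiallyIdentical : Set (c ⊔ ℓ)
    PotentiallyIdentical = ∃[ σ ] Counterclockwise σ × Identical (f ^ (σ ⟨$⟩ʳ_))

  shifts : ∀ {n} .{{_ : NonZero n}} → (Fin n → Linear) → Permutation′ n → Fin n → Linear
  shifts f τ i = f ^ shift (toℕ i) τ

  module Cyclic {n} .{{_ : NonZero n}} (x : Fin n → Linear) =
    CyclicSequence _≈ᴸ_ _≤ᴸ_ x

{-# OPTIONS --safe #-}

-- Write g₀ , … , gₙ₋₁ for the functions in the order τ and Fₖ = f^{τ_k}.  Since
-- Fₖ₊₁ ∘ gₖ = gₖ ∘ Fₖ, all Fₖ have the same slope, hence are ordered by their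
-- intercepts Bₖ, and Bₖ₊₁ - Bₖ is the cross product of the vectors of gₖ and Fₖ, a
-- negative multiple of sin (θ(gₖ) - θ(Fₖ)); it is also a negative multiple of
-- sin (θ(gₖ) - θ(Fₖ₊₁)).  Let uₖ be θ(gₖ) - θ(Fₖ), with θ(gₖ) lifted to a
-- nondecreasing sequence that grows by 2π per turn.  Consecutive θ(Fₖ) differ by
-- less than π, so by the two sine formulas replacing Fₖ by Fₖ₊₁ never moves uₖ back
-- over a multiple of π.  So u crosses each multiple of π once, Bₖ falls while
-- 0 ≤ uₖ ≤ π and rises while π ≤ uₖ ≤ 2π, and a step with uₖ = 0 (or π) starts at a
-- maximum (or minimum).  If some Fₖ has no polar angle, all Fₖ are the identity.
module Submission where

open import Defs
open import Data.Nat.Base using (ℕ; suc; NonZero)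
open import Data.Fin.Base using (Fin; toℕ)
open import Data.Fin.Permutation using (Permutation′; _⟨$⟩ʳ_)
open import Data.Product.Base using (_×_)
open import Data.Sum.Base using (_⊎_)
open import Relation.Nullary.Negation.Core using (¬_)

open import Algebra.Bundles using (CommutativeRing)
import Algebra.Properties.Ring as RingProperties
import Algebra.Properties.Semiring.Mult.TCOptimised as SemiringMult
import Algebra.Solver.Ring as RingSolver
open import Algebra.Solver.Ring.AlmostCommutativeRing
  using (AlmostCommutativeRing; fromCommutativeRing; _-Raw-AlmostCommutative⟶_; Induced-equivalence)
open import Data.Fin.Base using (zero; suc)
open import Data.Fin.Properties using (toℕ-injective; toℕ-fromℕ<; toℕ<n)
open import Data.Integer.Base as ℤ using (ℤ; +_; -[1+_]; _⊖_)
import Data.Integer.Properties as ℤₚ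
open import Data.List.Base using (List; []; _∷_; take; drop; _++_; length; tabulate; mapMaybe; map)
import Data.List.Properties as Listₚ
open import Data.List.Relation.Unary.Linked using (Linked; _∷_)
open import Data.Maybe.Base using (Maybe; just; nothing)
open import Data.Maybe.Properties using (just-injective)
open import Data.Maybe.Relation.Binary.Pointwise using (just)
open import Data.Nat.Base as ℕ using (zero)
open import Data.Nat.Divisibility using (divides-refl)
open import Data.Nat.DivMod
open import Data.Nat.Properties as ℕₚ using ()
open import Data.Product.Base using (∃-syntax; _,_; proj₁; proj₂)
open import Data.Sum.Base using (inj₁; inj₂)
import Data.Vec.Functional as Vector
open import Function.Base using (id; _∘_)
import Level
open import Relation.Binary.Core using (Rel)
open import Relation.Binary.Definitions using (WeaklyDecidable)
open import Relation.Binary.PropositionalEquality.Core as ≡ using (_≡_)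
import Relation.Binary.PropositionalEquality.Properties as ≡
import Relation.Binary.Reasoning.Setoid as SetoidReasoning
open import Relation.Binary.Structures using (IsDecTotalOrder)
open import Relation.Nullary.Decidable.Core using (Dec; yes; no; _×-dec_)
open import Relation.Nullary.Negation.Core using (contradiction)

-- Consecutive `θ(Fₖ)` differ by less than `π` because all the vectors of the composites have the
-- same second coordinate `1 - slope`, hence lie on one horizontal line. If that line misses the
-- origin, all their angles lie in `(0, π)` or all in `(π, 2π)`. If it passes through the origin,
-- the composites are translations, and conjugation by `gₖ` multiplies the translation by the
-- positive slope of `gₖ`, so no direction is reversed. Thus `θ(Fₖ)` needs no lift, and the growth
-- of `u` by `2π` per turn is due to the `gₖ` alone. The second sine formula holds because replacing
-- `Fₖ` by `Fₖ₊₁` multiplies the cross product with `gₖ` by the slope of `gₖ`. Unimodality is read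
-- off from a position where the intercept is least. The turn may close after `u` has passed `π`
-- again, where the intercept rises; but it then rises only to the least value, so those steps are
-- flat and still count as descent.

remaining : ∀ {n m} → m ℕ.≤ n → ∀ i → (n ℕ.∸ m) ℕ.+ (m ℕ.+ i) ≡ n ℕ.+ i
remaining {n} {m} m≤n i = ≡.trans (≡.sym (ℕₚ.+-assoc (n ℕ.∸ m) m i)) (≡.cong (ℕ._+ i) (ℕₚ.m∸n+n≡m m≤n))

-- This finds the top of the unimodal sequence, with positivity of the lifted angle as `P`. If `P`
-- fails at the last index, it fails at all earlier ones, and the threshold is `n` itself.
crossing : ∀ {p} (P : ℕ → Set p) → (∀ m → Dec (P m)) → (∀ m → P m → P (suc m)) → ∀ n →
  ∃[ l ] l ℕ.≤ n × (∀ {m} → m ℕ.< l → ¬ P m) × (∀ {m} → l ℕ.≤ m → m ℕ.< n → P m)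
crossing P P? up zero = zero , ℕ.z≤n , (λ ()) , λ _ ()
crossing P P? up (suc n) with P? n
... | no ¬p = suc n , ℕₚ.≤-refl , (λ m<1+n p → ¬p (persist (ℕₚ.≤⇒≤′ (ℕ.s≤s⁻¹ m<1+n)) p)) ,
              λ n<m m<1+n → contradiction (ℕₚ.≤-trans m<1+n n<m) (ℕₚ.<-irrefl ≡.refl)
  where
  persist : ∀ {m k} → m ℕ.≤′ k → P m → P k
  persist ℕ.≤′-refl       p = p
  persist (ℕ.≤′-step m≤k) p = up _ (persist m≤k p)
... | yes p with l , l≤n , before , after ← crossing P P? up n =
  l , ℕₚ.m≤n⇒m≤1+n l≤n , before , after′
  where
  after′ : ∀ {m} → l ℕ.≤ m → m ℕ.< suc n → P m
  after′ {m} l≤m m<1+n with ℕₚ.m≤n⇒m<n∨m≡n (ℕ.s≤s⁻¹ m<1+n)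
  ... | inj₁ m<n    = after l≤m m<n
  ... | inj₂ ≡.refl = p

-- Lists read by position.

module _ {a} {A : Set a} where

  nth : List A → ℕ → Maybe A
  nth []       _       = nothing
  nth (x ∷ xs) zero    = just x
  nth (x ∷ xs) (suc i) = nth xs i

  linked-nth : ∀ {r} {_∼_ : Rel A r} {xs x y} → Linked _∼_ xs → ∀ i →
               nth xs i ≡ just x → nth xs (suc i) ≡ just y → x ∼ y
  linked-nth (x∼y ∷ _) zero    ≡.refl ≡.refl = x∼y
  linked-nth (_ ∷ l)   (suc i) p      q      = linked-nth l i p q

  nth-drop : ∀ k xs i → nth (drop k xs) i ≡ nth xs (k ℕ.+ i)
  nth-drop zero    xs       i = ≡.refl
  nth-drop (suc k) []       i = ≡.refl
  nth-drop (suc k) (x ∷ xs) i = nth-drop k xs i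

  nth-take : ∀ {k} xs {i} → i ℕ.< k → nth (take k xs) i ≡ nth xs i
  nth-take {suc k} []       _               = ≡.refl
  nth-take {suc k} (x ∷ xs) {zero}  _       = ≡.refl
  nth-take {suc k} (x ∷ xs) {suc i} i<k     = nth-take xs (ℕ.s<s⁻¹ i<k)

  nth-++ˡ : ∀ xs {ys i} → i ℕ.< length xs → nth (xs ++ ys) i ≡ nth xs i
  nth-++ˡ (x ∷ xs) {i = zero}  _   = ≡.refl
  nth-++ˡ (x ∷ xs) {i = suc i} i<l = nth-++ˡ xs (ℕ.s<s⁻¹ i<l)

  nth-++ʳ : ∀ xs {ys} i → nth (xs ++ ys) (length xs ℕ.+ i) ≡ nth ys i
  nth-++ʳ []       i = ≡.refl
  nth-++ʳ (x ∷ xs) i = nth-++ʳ xs i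

  nth-tabulate : ∀ {n} (h : Fin n → A) i → nth (tabulate h) (toℕ i) ≡ just (h i)
  nth-tabulate h zero    = ≡.refl
  nth-tabulate h (suc i) = nth-tabulate (λ j → h (suc j)) i

-- Non-identical functions all have an angle, so nothing is discarded and places in the list of
-- angles agree with positions of the permutation.
mapMaybe-total : ∀ {a b} {A : Set a} {B : Set b} {g : A → Maybe B} {h : A → B} →
                 (∀ x → g x ≡ just (h x)) → ∀ xs → mapMaybe g xs ≡ map h xs
mapMaybe-total g≡h []       = ≡.refl
mapMaybe-total {g = g} g≡h (x ∷ xs) rewrite g≡h x = ≡.cong (_ ∷_) (mapMaybe-total g≡h xs)

-- Residues modulo `n` and rotated lists.

module _ {n : ℕ} .{{_ : NonZero n}} where
  open ≡.≡-Reasoning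

  mod-cong-% : ∀ {i j} → i % n ≡ j % n → i mod n ≡ j mod n
  mod-cong-% p = toℕ-injective (≡.trans (toℕ-fromℕ< _) (≡.trans p (≡.sym (toℕ-fromℕ< _))))

  mod-toℕ : ∀ i → toℕ i mod n ≡ i
  mod-toℕ i = toℕ-injective (≡.trans (toℕ-fromℕ< _) (m<n⇒m%n≡m (toℕ<n i)))

  [n+m]%n≡m%n : ∀ m → (n ℕ.+ m) % n ≡ m % n
  [n+m]%n≡m%n m = ≡.trans (%-congˡ (ℕₚ.+-comm n m)) ([m+n]%n≡m%n m n)

  [n+m]/n≡1+m/n : ∀ m → (n ℕ.+ m) / n ≡ suc (m / n)
  [n+m]/n≡1+m/n m = ≡.trans (m/n≡1+[m∸n]/n (ℕₚ.m≤m+n n m)) (≡.cong (λ k → suc (k / n)) (ℕₚ.m+n∸m≡n n m))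

  [m+k%n]%n≡[m+k]%n : ∀ m k → (m ℕ.+ k % n) % n ≡ (m ℕ.+ k) % n
  [m+k%n]%n≡[m+k]%n m k = begin
    (m ℕ.+ k % n) % n          ≡⟨ %-distribˡ-+ m (k % n) n ⟩
    (m % n ℕ.+ k % n % n) % n  ≡⟨ ≡.cong (λ r → (m % n ℕ.+ r) % n) (m%n%n≡m%n k n) ⟩
    (m % n ℕ.+ k % n) % n      ≡⟨ %-distribˡ-+ m k n ⟨
    (m ℕ.+ k) % n              ∎

  -- The quotient counts completed passes through the rotated list. It is constant inside a pass and
  -- grows by one at the seam, where the lift of the angles adds a full turn.
  suc-%-/ : ∀ J → (suc (J % n) ℕ.< n × suc J / n ≡ J / n) ⊎ (suc J / n ≡ suc (J / n))
  suc-%-/ J with ℕₚ.m≤n⇒m<n∨m≡n (m%n<n J n)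
  ... | inj₁ r<n = inj₁ (r<n , ≡.trans quotient (≡.cong (ℕ._+ J / n) (m<n⇒m/n≡0 r<n)))
    where
    quotient : suc J / n ≡ suc (J % n) / n ℕ.+ J / n
    quotient = begin
      suc J / n                                   ≡⟨ /-congˡ (≡.cong suc (m≡m%n+[m/n]*n J n)) ⟩
      (suc (J % n) ℕ.+ J / n ℕ.* n) / n           ≡⟨ +-distrib-/-∣ʳ (suc (J % n)) (divides-refl (J / n)) ⟩
      suc (J % n) / n ℕ.+ J / n ℕ.* n / n         ≡⟨ ≡.cong (suc (J % n) / n ℕ.+_) (m*n/n≡m (J / n) n) ⟩
      suc (J % n) / n ℕ.+ J / n                   ∎
  ... | inj₂ r≡n = inj₂ (begin
      suc J / n                                   ≡⟨ /-congˡ (≡.cong suc (m≡m%n+[m/n]*n J n)) ⟩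
      (suc (J % n) ℕ.+ J / n ℕ.* n) / n           ≡⟨ /-congˡ (≡.cong (ℕ._+ J / n ℕ.* n) r≡n) ⟩
      (n ℕ.+ J / n ℕ.* n) / n                     ≡⟨ [n+m]/n≡1+m/n (J / n ℕ.* n) ⟩
      suc (J / n ℕ.* n / n)                       ≡⟨ ≡.cong suc (m*n/n≡m (J / n) n) ⟩
      suc (J / n)                                 ∎)

  module _ {a} {A : Set a} (h : Fin n → A) where

    nth-mod : ∀ {i} → i ℕ.< n → nth (tabulate h) i ≡ just (h (i mod n))
    nth-mod {i} i<n = begin
      nth (tabulate h) i                ≡⟨ ≡.cong (nth (tabulate h)) (≡.trans (toℕ-fromℕ< _) (m<n⇒m%n≡m i<n)) ⟨
      nth (tabulate h) (toℕ (i mod n))  ≡⟨ nth-tabulate h (i mod n) ⟩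
      just (h (i mod n))                ∎

    nth-rotate : ∀ {k} → k ℕ.≤ n → ∀ {r} → r ℕ.< n →
      nth (drop k (tabulate h) ++ take k (tabulate h)) r ≡ just (h ((k ℕ.+ r) mod n))
    nth-rotate {k} k≤n {r} r<n with ℕₚ.<-≤-connex r (length (drop k (tabulate h)))
    ... | inj₁ r<l = begin
        nth (drop k L ++ take k L) r  ≡⟨ nth-++ˡ (drop k L) r<l ⟩
        nth (drop k L) r              ≡⟨ nth-drop k L r ⟩
        nth L (k ℕ.+ r)               ≡⟨ nth-mod k+r<n ⟩
        just (h ((k ℕ.+ r) mod n))    ∎
      where
      L = tabulate h
      k+r<n : k ℕ.+ r ℕ.< n
      k+r<n = ≡.subst (ℕ._≤ n) (ℕₚ.+-suc k r) (≡.subst (k ℕ.+ suc r ℕ.≤_) (ℕₚ.m+[n∸m]≡n k≤n)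
        (ℕₚ.+-monoʳ-≤ k (≡.subst (r ℕ.<_) (≡.trans (Listₚ.length-drop k L) (≡.cong (ℕ._∸ k) (Listₚ.length-tabulate h))) r<l)))
    ... | inj₂ l≤r = begin
        nth (drop k L ++ take k L) r                                    ≡⟨ ≡.cong (nth (drop k L ++ take k L)) (ℕₚ.m+[n∸m]≡n l≤r) ⟨
        nth (drop k L ++ take k L) (length (drop k L) ℕ.+ i)            ≡⟨ nth-++ʳ (drop k L) i ⟩
        nth (take k L) i                                                ≡⟨ nth-take L i<k ⟩
        nth L i                                                         ≡⟨ nth-mod (ℕₚ.<-≤-trans i<k k≤n) ⟩
        just (h (i mod n))                                              ≡⟨ ≡.cong (λ j → just (h j)) (mod-cong-% (≡.trans (≡.sym ([n+m]%n≡m%n i)) (%-congˡ n+i≡k+r))) ⟩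
        just (h ((k ℕ.+ r) mod n))                                      ∎
      where
      L = tabulate h
      i = r ℕ.∸ length (drop k L)
      n+i≡k+r : n ℕ.+ i ≡ k ℕ.+ r
      n+i≡k+r = begin
        n ℕ.+ i                              ≡⟨ ≡.cong (ℕ._+ i) (ℕₚ.m+[n∸m]≡n k≤n) ⟨
        (k ℕ.+ (n ℕ.∸ k)) ℕ.+ i              ≡⟨ ≡.cong (λ l → (k ℕ.+ l) ℕ.+ i) (≡.trans (Listₚ.length-drop k L) (≡.cong (ℕ._∸ k) (Listₚ.length-tabulate h))) ⟨
        (k ℕ.+ length (drop k L)) ℕ.+ i      ≡⟨ ℕₚ.+-assoc k _ i ⟩
        k ℕ.+ (length (drop k L) ℕ.+ i)      ≡⟨ ≡.cong (k ℕ.+_) (ℕₚ.m+[n∸m]≡n l≤r) ⟩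
        k ℕ.+ r                              ∎
      i<k : i ℕ.< k
      i<k = ℕₚ.+-cancelˡ-< n i k (≡.subst (ℕ._< n ℕ.+ k) (≡.sym n+i≡k+r)
        (≡.subst (k ℕ.+ r ℕ.<_) (ℕₚ.+-comm k n) (ℕₚ.+-monoʳ-< k r<n)))

    -- `s` is the inverse rotation: position `j` stands at place `(s + j) % n` of the rotated list.
    -- The side condition says that `j` and its successor are neighbours there; the only pair left
    -- out is the seam.
    linked-rotate-≤ : ∀ {r} {_∼_ : Rel A r} {k} → k ℕ.≤ n →
      Linked _∼_ (drop k (tabulate h) ++ take k (tabulate h)) →
      ∃[ s ] ∀ j → suc ((s ℕ.+ j) % n) ℕ.< n → h (j mod n) ∼ h (suc j mod n)
    linked-rotate-≤ {_∼_ = _∼_} {k} k≤n l = n ℕ.∸ k , λ j r<n → ≡.subst₂ _∼_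
      (≡.cong h (mod-cong-% (position j)))
      (≡.cong h (mod-cong-% (begin
        (k ℕ.+ suc (((n ℕ.∸ k) ℕ.+ j) % n)) % n   ≡⟨ %-congˡ (ℕₚ.+-suc k _) ⟩
        suc (k ℕ.+ ((n ℕ.∸ k) ℕ.+ j) % n) % n     ≡⟨ [m+k%n]%n≡[m+k]%n 1 _ ⟨
        suc ((k ℕ.+ ((n ℕ.∸ k) ℕ.+ j) % n) % n) % n ≡⟨ %-congˡ (≡.cong suc (position j)) ⟩
        suc (j % n) % n                           ≡⟨ [m+k%n]%n≡[m+k]%n 1 j ⟩
        suc j % n                                 ∎)))
      (linked-nth l _ (nth-rotate k≤n (ℕₚ.<-trans (ℕₚ.n<1+n _) r<n)) (nth-rotate k≤n r<n))
      where
      position : ∀ j → (k ℕ.+ ((n ℕ.∸ k) ℕ.+ j) % n) % n ≡ j % n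
      position j = begin
        (k ℕ.+ ((n ℕ.∸ k) ℕ.+ j) % n) % n  ≡⟨ [m+k%n]%n≡[m+k]%n k _ ⟩
        (k ℕ.+ ((n ℕ.∸ k) ℕ.+ j)) % n      ≡⟨ %-congˡ (ℕₚ.+-assoc k (n ℕ.∸ k) j) ⟨
        (k ℕ.+ (n ℕ.∸ k) ℕ.+ j) % n        ≡⟨ %-congˡ (≡.cong (ℕ._+ j) (ℕₚ.m+[n∸m]≡n k≤n)) ⟩
        (n ℕ.+ j) % n                      ≡⟨ [n+m]%n≡m%n j ⟩
        j % n                              ∎

    linked-rotate : ∀ {r} {_∼_ : Rel A r} k → Linked _∼_ (drop k (tabulate h) ++ take k (tabulate h)) →
      ∃[ s ] ∀ j → suc ((s ℕ.+ j) % n) ℕ.< n → h (j mod n) ∼ h (suc j mod n)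
    linked-rotate {_∼_ = _∼_} k l with k ℕₚ.≤? n
    ... | yes k≤n = linked-rotate-≤ k≤n l
    -- A cut beyond the end leaves the list as it is, which is the rotation by `0`.
    ... | no  k≰n = linked-rotate-≤ {k = 0} ℕ.z≤n (≡.subst (Linked _∼_)
        (≡.trans (≡.cong₂ _++_ (Listₚ.drop-all k L l≤k) (Listₚ.take-all k L l≤k)) (≡.sym (Listₚ.++-identityʳ L))) l)
      where
      L = tabulate h
      l≤k : length L ℕ.≤ k
      l≤k = ℕₚ.≤-trans (ℕₚ.≤-reflexive (Listₚ.length-tabulate h)) (ℕₚ.<⇒≤ (ℕₚ.≰⇒> k≰n))

-- Ordered-field algebra and a ring solver with integer coefficients.

module OrderedField {c ℓ} (R : Reals c ℓ) where
  open Reals R public hiding (zero)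
  open RingProperties ring public using (-‿+-comm; -‿distribˡ-*; -‿distribʳ-*; -‿involutive; -0#≈0#)
  open SemiringMult semiring public using (×-homo-+; ×1-homo-*; 1+×) renaming (_×_ to _×ᴿ_)
  open IsDecTotalOrder isDecTotalOrder public
    using (antisym; total; ≤-respˡ-≈; ≤-respʳ-≈)
    renaming (refl to ≤-refl; trans to ≤-trans; reflexive to ≤-reflexive)

  -- The canonical homomorphism from the integers. With the optimised multiple `_×ᴿ_`, `⟪ + 1 ⟫`
  -- computes to `1#`, so `con (+ 1)` in a solver equation is `1#` itself.
  ⟪_⟫ : ℤ → Carrier
  ⟪ + n ⟫      = n ×ᴿ 1#
  ⟪ -[1+ n ] ⟫ = - (suc n ×ᴿ 1#)

  ⟪⟫-neg : ∀ z → ⟪ ℤ.- z ⟫ ≈ - ⟪ z ⟫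
  ⟪⟫-neg (+ zero)  = sym -0#≈0#
  ⟪⟫-neg (+ suc n) = refl
  ⟪⟫-neg -[1+ n ]  = sym (-‿involutive _)

  ⟪⟫-⊖ : ∀ m n → ⟪ m ⊖ n ⟫ ≈ m ×ᴿ 1# - n ×ᴿ 1#
  ⟪⟫-⊖ m       zero    = sym (trans (+-congˡ -0#≈0#) (+-identityʳ _))
  ⟪⟫-⊖ zero    (suc n) = sym (+-identityˡ _)
  ⟪⟫-⊖ (suc m) (suc n) = begin
    ⟪ suc m ⊖ suc n ⟫              ≡⟨ ≡.cong ⟪_⟫ (ℤₚ.[1+m]⊖[1+n]≡m⊖n m n) ⟩
    ⟪ m ⊖ n ⟫                      ≈⟨ ⟪⟫-⊖ m n ⟩
    x - y                          ≈⟨ +-congʳ (+-identityˡ x) ⟨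
    (0# + x) - y                   ≈⟨ +-congʳ (+-congʳ (-‿inverseʳ 1#)) ⟨
    ((1# - 1#) + x) - y            ≈⟨ +-congʳ (+-assoc 1# (- 1#) x) ⟩
    (1# + (- 1# + x)) - y          ≈⟨ +-congʳ (+-congˡ (+-comm (- 1#) x)) ⟩
    (1# + (x - 1#)) - y            ≈⟨ +-congʳ (+-assoc 1# x (- 1#)) ⟨
    ((1# + x) - 1#) - y            ≈⟨ +-assoc (1# + x) (- 1#) (- y) ⟩
    (1# + x) + (- 1# - y)          ≈⟨ +-congˡ (-‿+-comm 1# y) ⟩
    (1# + x) - (1# + y)            ≈⟨ +-cong (1+× m 1#) (-‿cong (1+× n 1#)) ⟨
    suc m ×ᴿ 1# - suc n ×ᴿ 1#      ∎
    where
    open SetoidReasoning setoid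
    x = m ×ᴿ 1#
    y = n ×ᴿ 1#

  ⟪⟫-+ : ∀ i j → ⟪ i ℤ.+ j ⟫ ≈ ⟪ i ⟫ + ⟪ j ⟫
  ⟪⟫-+ (+ m)    (+ n)    = ×-homo-+ 1# m n
  ⟪⟫-+ (+ m)    -[1+ n ] = ⟪⟫-⊖ m (suc n)
  ⟪⟫-+ -[1+ m ] (+ n)    = trans (⟪⟫-⊖ n (suc m)) (+-comm _ _)
  ⟪⟫-+ -[1+ m ] -[1+ n ] = begin
    ⟪ -[1+ m ] ℤ.+ -[1+ n ] ⟫             ≡⟨ ≡.cong ⟪_⟫ (ℤₚ.neg-distrib-+ (+ suc m) (+ suc n)) ⟨
    ⟪ ℤ.- (+ suc m ℤ.+ + suc n) ⟫         ≈⟨ ⟪⟫-neg (+ suc m ℤ.+ + suc n) ⟩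
    - ⟪ + suc m ℤ.+ + suc n ⟫             ≈⟨ -‿cong (×-homo-+ 1# (suc m) (suc n)) ⟩
    - (⟪ + suc m ⟫ + ⟪ + suc n ⟫)         ≈⟨ -‿+-comm _ _ ⟨
    ⟪ -[1+ m ] ⟫ + ⟪ -[1+ n ] ⟫           ∎
    where open SetoidReasoning setoid

  ⟪⟫-*⁺ : ∀ m j → ⟪ + m ℤ.* j ⟫ ≈ ⟪ + m ⟫ * ⟪ j ⟫
  ⟪⟫-*⁺ m (+ n)    = trans (reflexive (≡.cong ⟪_⟫ (≡.sym (ℤₚ.pos-* m n)))) (×1-homo-* m n)
  ⟪⟫-*⁺ m -[1+ n ] = begin
    ⟪ + m ℤ.* -[1+ n ] ⟫        ≡⟨ ≡.cong ⟪_⟫ (ℤₚ.neg-distribʳ-* (+ m) (+ suc n)) ⟨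
    ⟪ ℤ.- (+ m ℤ.* + suc n) ⟫   ≈⟨ ⟪⟫-neg (+ m ℤ.* + suc n) ⟩
    - ⟪ + m ℤ.* + suc n ⟫       ≈⟨ -‿cong (⟪⟫-*⁺ m (+ suc n)) ⟩
    - (⟪ + m ⟫ * ⟪ + suc n ⟫)   ≈⟨ -‿distribʳ-* _ _ ⟩
    ⟪ + m ⟫ * ⟪ -[1+ n ] ⟫      ∎
    where open SetoidReasoning setoid

  ⟪⟫-* : ∀ i j → ⟪ i ℤ.* j ⟫ ≈ ⟪ i ⟫ * ⟪ j ⟫
  ⟪⟫-* (+ m)    j = ⟪⟫-*⁺ m j
  ⟪⟫-* -[1+ m ] j = begin
    ⟪ -[1+ m ] ℤ.* j ⟫          ≡⟨ ≡.cong ⟪_⟫ (ℤₚ.neg-distribˡ-* (+ suc m) j) ⟨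
    ⟪ ℤ.- (+ suc m ℤ.* j) ⟫     ≈⟨ ⟪⟫-neg (+ suc m ℤ.* j) ⟩
    - ⟪ + suc m ℤ.* j ⟫         ≈⟨ -‿cong (⟪⟫-*⁺ (suc m) j) ⟩
    - (⟪ + suc m ⟫ * ⟪ j ⟫)     ≈⟨ -‿distribˡ-* _ _ ⟩
    ⟪ -[1+ m ] ⟫ * ⟪ j ⟫        ∎
    where open SetoidReasoning setoid

  almostCommutativeRing : AlmostCommutativeRing c ℓ
  almostCommutativeRing = fromCommutativeRing commutativeRing

  -- The solver needs computing coefficients, so these are integers rather than
  -- elements of the abstract field.
  ℤ⟶R : CommutativeRing.rawRing ℤₚ.+-*-commutativeRing -Raw-AlmostCommutative⟶ almostCommutativeRing
  ℤ⟶R = record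
    { ⟦_⟧    = ⟪_⟫
    ; +-homo = ⟪⟫-+
    ; *-homo = ⟪⟫-*
    ; -‿homo = ⟪⟫-neg
    ; 0-homo = refl
    ; 1-homo = refl
    }

  ⟪⟫-≟ : WeaklyDecidable (Induced-equivalence ℤ⟶R)
  ⟪⟫-≟ i j with i ℤₚ.≟ j
  ... | yes i≡j = just (reflexive (≡.cong ⟪_⟫ i≡j))
  ... | no _    = nothing

  open RingSolver _ almostCommutativeRing ℤ⟶R ⟪⟫-≟ public
    using (solve; con; _:+_; _:*_; _:-_; :-_; _:=_)

  -- Inequalities are carried along an equality of differences, which reduces each rearrangement to
  -- a single ring identity for the solver.
  ≤-by : ∀ {x y z w} → x ≤ y → y - x ≈ w - z → z ≤ w
  ≤-by {x} {y} {z} {w} x≤y d = ≤-respˡ-≈ e₁ (≤-respʳ-≈ e₂ (+-mono-≤ (z - x) x≤y))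
    where
    e₁ : x + (z - x) ≈ z
    e₁ = solve 2 (λ x z → x :+ (z :- x) := z) refl x z
    e₂ : y + (z - x) ≈ w
    e₂ = trans (solve 3 (λ x y z → y :+ (z :- x) := (y :- x) :+ z) refl x y z)
         (trans (+-congʳ d) (solve 2 (λ w z → (w :- z) :+ z := w) refl w z))

  <-by : ∀ {x y z w} → x < y → y - x ≈ w - z → z < w
  <-by {x} {y} {z} {w} (x≤y , x≉y) d = ≤-by x≤y d , λ z≈w → x≉y (begin
    x              ≈⟨ solve 2 (λ x y → x := y :- (y :- x)) refl x y ⟩
    y - (y - x)    ≈⟨ +-congˡ (-‿cong d) ⟩
    y - (w - z)    ≈⟨ +-congˡ (-‿cong (+-congˡ (-‿cong z≈w))) ⟩
    y - (w - w)    ≈⟨ solve 2 (λ y w → y :- (w :- w) := y) refl y w ⟩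
    y              ∎)
    where open SetoidReasoning setoid

  ≤-add : ∀ {x y z w} → x ≤ y → z ≤ w → x + z ≤ y + w
  ≤-add {x} {y} {z} {w} x≤y z≤w = ≤-trans (+-mono-≤ z x≤y)
    (≤-by z≤w (solve 3 (λ y z w → w :- z := (y :+ w) :- (y :+ z)) refl y z w))

  <-≤-trans : ∀ {x y z} → x < y → y ≤ z → x < z
  <-≤-trans (x≤y , x≉y) y≤z =
    ≤-trans x≤y y≤z , λ x≈z → x≉y (antisym x≤y (≤-respʳ-≈ (sym x≈z) y≤z))

  ≤-<-trans : ∀ {x y z} → x ≤ y → y < z → x < z
  ≤-<-trans x≤y (y≤z , y≉z) =
    ≤-trans x≤y y≤z , λ x≈z → y≉z (antisym y≤z (≤-respˡ-≈ x≈z x≤y))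

  <-trans : ∀ {x y z} → x < y → y < z → x < z
  <-trans x<y (y≤z , _) = <-≤-trans x<y y≤z

  <-≤-add : ∀ {x y z w} → x < y → z ≤ w → x + z < y + w
  <-≤-add {x} {y} {z} {w} x<y z≤w = <-≤-trans
    (<-by x<y (solve 3 (λ x y z → y :- x := (y :+ z) :- (x :+ z)) refl x y z))
    (≤-add ≤-refl z≤w)

  <-respˡ-≈ : ∀ {x y z} → x ≈ y → x < z → y < z
  <-respˡ-≈ x≈y x<z = ≤-<-trans (≤-reflexive (sym x≈y)) x<z

  <-respʳ-≈ : ∀ {x y z} → x ≈ y → z < x → z < y
  <-respʳ-≈ x≈y z<x = <-≤-trans z<x (≤-reflexive x≈y)

  ≤⇒≯ : ∀ {x y} → x ≤ y → ¬ (y < x)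
  ≤⇒≯ x≤y (y≤x , y≉x) = y≉x (antisym y≤x x≤y)

  ≰⇒> : ∀ {x y} → ¬ (x ≤ y) → y < x
  ≰⇒> {x} {y} x≰y with total x y
  ... | inj₁ x≤y = contradiction x≤y x≰y
  ... | inj₂ y≤x = y≤x , λ y≈x → x≰y (≤-reflexive (sym y≈x))

  ≤-or-> : ∀ x y → x ≤ y ⊎ y < x
  ≤-or-> x y with x ≤? y
  ... | yes x≤y = inj₁ x≤y
  ... | no  x≰y = inj₂ (≰⇒> x≰y)

  ≤⇒<-or-≈ : ∀ {x y} → x ≤ y → x < y ⊎ x ≈ y
  ≤⇒<-or-≈ {x} {y} x≤y with x ≟ y
  ... | yes x≈y = inj₂ x≈y
  ... | no  x≉y = inj₁ (x≤y , x≉y)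

  *-cancelˡ-0 : ∀ {x y} → ¬ (x ≈ 0#) → x * y ≈ 0# → y ≈ 0#
  *-cancelˡ-0 {x} {y} x≉0 xy≈0 with inverse x x≉0
  ... | x⁻¹ , xx⁻¹≈1 = begin
    y              ≈⟨ *-identityˡ y ⟨
    1# * y         ≈⟨ *-congʳ xx⁻¹≈1 ⟨
    (x * x⁻¹) * y  ≈⟨ solve 3 (λ x i y → (x :* i) :* y := i :* (x :* y)) refl x x⁻¹ y ⟩
    x⁻¹ * (x * y)  ≈⟨ *-congˡ xy≈0 ⟩
    x⁻¹ * 0#       ≈⟨ zeroʳ x⁻¹ ⟩
    0#             ∎
    where open SetoidReasoning setoid

  square≈0⇒≈0 : ∀ {x} → x * x ≈ 0# → x ≈ 0#
  square≈0⇒≈0 {x} xx≈0 with x ≟ 0#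
  ... | yes x≈0 = x≈0
  ... | no  x≉0 = *-cancelˡ-0 x≉0 xx≈0

  0<⇒≉0 : ∀ {x} → 0# < x → ¬ (x ≈ 0#)
  0<⇒≉0 (_ , 0≉x) x≈0 = 0≉x (sym x≈0)

  *-pos : ∀ {x y} → 0# < x → 0# < y → 0# < x * y
  *-pos 0<x 0<y = *-nonneg (proj₁ 0<x) (proj₁ 0<y) ,
    λ 0≈xy → 0<⇒≉0 0<y (*-cancelˡ-0 (0<⇒≉0 0<x) (sym 0≈xy))

  neg-≤⁻¹ : ∀ {x y} → - y ≤ - x → x ≤ y
  neg-≤⁻¹ {x} {y} p = ≤-by p (solve 2 (λ x y → (:- x) :- (:- y) := y :- x) refl x y)

  ≤0⇒0≤- : ∀ {x} → x ≤ 0# → 0# ≤ - x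
  ≤0⇒0≤- {x} x≤0 = ≤-by x≤0 (solve 1 (λ x → con (+ 0) :- x := (:- x) :- con (+ 0)) refl x)

  0≤-⇒≤0 : ∀ {x} → 0# ≤ - x → x ≤ 0#
  0≤-⇒≤0 {x} 0≤-x = ≤-by 0≤-x (solve 1 (λ x → (:- x) :- con (+ 0) := con (+ 0) :- x) refl x)

  <0⇒0<- : ∀ {x} → x < 0# → 0# < - x
  <0⇒0<- {x} x<0 = <-by x<0 (solve 1 (λ x → con (+ 0) :- x := (:- x) :- con (+ 0)) refl x)

  ≮⇒≥ : ∀ {x y} → ¬ (x < y) → y ≤ x
  ≮⇒≥ {x} {y} x≮y with ≤-or-> y x
  ... | inj₁ y≤x = y≤x
  ... | inj₂ x<y = contradiction x<y x≮y

  <-decide : ∀ x y → Dec (x < y)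
  <-decide x y with ≤-or-> y x
  ... | inj₁ y≤x = no (≤⇒≯ y≤x)
  ... | inj₂ x<y = yes x<y

-- Trigonometry from the axioms.

module Angles {c ℓ} (R : Reals c ℓ) (T : Trigonometry R) where
  open OrderedField R public
  open Trigonometry T public
  open SetoidReasoning setoid

  -- `cos-sub` with equal arguments is the Pythagorean identity. Where one of the two functions has
  -- square `1`, the other has square `0`; `sin-π` and `cos-½π` follow in the same way.
  sin-0 : sin 0# ≈ 0#
  sin-0 = square≈0⇒≈0 (begin
    s * s                  ≈⟨ solve 1 (λ s → s :* s := (con (+ 1) :* con (+ 1) :+ s :* s) :- con (+ 1)) refl s ⟩
    (1# * 1# + s * s) - 1# ≈⟨ +-congʳ (+-congʳ (*-cong cos-0 cos-0)) ⟨
    (cos 0# * cos 0# + s * s) - 1# ≈⟨ +-congʳ (cos-sub 0# 0#) ⟨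
    cos (0# - 0#) - 1#     ≈⟨ +-congʳ (trans (cos-cong (-‿inverseʳ 0#)) cos-0) ⟩
    1# - 1#                ≈⟨ -‿inverseʳ 1# ⟩
    0#                     ∎)
    where s = sin 0#

  sin-π : sin π ≈ 0#
  sin-π = square≈0⇒≈0 (begin
    s * s                  ≈⟨ solve 1 (λ s → s :* s := ((:- con (+ 1)) :* (:- con (+ 1)) :+ s :* s) :- con (+ 1)) refl s ⟩
    (- 1# * - 1# + s * s) - 1# ≈⟨ +-congʳ (+-congʳ (*-cong cos-π cos-π)) ⟨
    (cos π * cos π + s * s) - 1# ≈⟨ +-congʳ (cos-sub π π) ⟨
    cos (π - π) - 1#       ≈⟨ +-congʳ (trans (cos-cong (-‿inverseʳ π)) cos-0) ⟩
    1# - 1#                ≈⟨ -‿inverseʳ 1# ⟩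
    0#                     ∎)
    where s = sin π

  cos-½π : cos ½π ≈ 0#
  cos-½π = square≈0⇒≈0 (begin
    k * k                  ≈⟨ solve 1 (λ s → s :* s := (s :* s :+ con (+ 1) :* con (+ 1)) :- con (+ 1)) refl k ⟩
    (k * k + 1# * 1#) - 1# ≈⟨ +-congʳ (+-congˡ (*-cong sin-½π sin-½π)) ⟨
    (k * k + sin ½π * sin ½π) - 1# ≈⟨ +-congʳ (cos-sub ½π ½π) ⟨
    cos (½π - ½π) - 1#     ≈⟨ +-congʳ (trans (cos-cong (-‿inverseʳ ½π)) cos-0) ⟩
    1# - 1#                ≈⟨ -‿inverseʳ 1# ⟩
    0#                     ∎)
    where k = cos ½π

  cos-neg : ∀ x → cos (- x) ≈ cos x
  cos-neg x = begin
    cos (- x)                          ≈⟨ cos-cong (+-identityˡ (- x)) ⟨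
    cos (0# - x)                       ≈⟨ cos-sub x 0# ⟩
    cos 0# * cos x + sin 0# * sin x    ≈⟨ +-cong (*-congʳ cos-0) (*-congʳ sin-0) ⟩
    1# * cos x + 0# * sin x            ≈⟨ solve 2 (λ k s → con (+ 1) :* k :+ con (+ 0) :* s := k) refl (cos x) (sin x) ⟩
    cos x                              ∎

  cos-co : ∀ x → cos (½π - x) ≈ sin x
  cos-co x = begin
    cos (½π - x)                       ≈⟨ cos-sub x ½π ⟩
    cos ½π * cos x + sin ½π * sin x    ≈⟨ +-cong (*-congʳ cos-½π) (*-congʳ sin-½π) ⟩
    0# * cos x + 1# * sin x            ≈⟨ solve 2 (λ k s → con (+ 0) :* k :+ con (+ 1) :* s := s) refl (cos x) (sin x) ⟩
    sin x                              ∎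

  sin-co : ∀ x → sin (½π - x) ≈ cos x
  sin-co x = trans (sym (cos-co (½π - x)))
    (cos-cong (solve 2 (λ h x → h :- (h :- x) := x) refl ½π x))

  sin-neg : ∀ x → sin (- x) ≈ - sin x
  sin-neg x = begin
    sin (- x)                                    ≈⟨ cos-co (- x) ⟨
    cos (½π - - x)                               ≈⟨ cos-cong (solve 2 (λ h x → h :- (:- x) := x :- (:- h)) refl ½π x) ⟩
    cos (x - - ½π)                               ≈⟨ cos-sub (- ½π) x ⟩
    cos x * cos (- ½π) + sin x * sin (- ½π)      ≈⟨ +-cong (*-congˡ (trans (cos-neg ½π) cos-½π)) (*-congˡ sin-½π-neg) ⟩
    cos x * 0# + sin x * - 1#                    ≈⟨ solve 2 (λ k s → k :* con (+ 0) :+ s :* (:- con (+ 1)) := :- s) refl (cos x) (sin x) ⟩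
    - sin x                                      ∎
    where
    sin-½π-neg : sin (- ½π) ≈ - 1#
    sin-½π-neg = begin
      sin (- ½π)       ≈⟨ cos-co (- ½π) ⟨
      cos (½π - - ½π)  ≈⟨ cos-cong (solve 1 (λ h → h :- (:- h) := h :+ h) refl ½π) ⟩
      cos π            ≈⟨ cos-π ⟩
      - 1#             ∎

  -- Sine is the cosine of the complement, so this is `cos-sub` at `½π - y` and `- x`.
  sin-sub : ∀ x y → sin (y - x) ≈ sin y * cos x - cos y * sin x
  sin-sub x y = begin
    sin (y - x)                                      ≈⟨ cos-co (y - x) ⟨
    cos (½π - (y - x))                               ≈⟨ cos-cong (solve 3 (λ h x y → h :- (y :- x) := (h :- y) :- (:- x)) refl ½π x y) ⟩
    cos ((½π - y) - - x)                             ≈⟨ cos-sub (- x) (½π - y) ⟩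
    cos (½π - y) * cos (- x) + sin (½π - y) * sin (- x) ≈⟨ +-cong (*-cong (cos-co y) (cos-neg x)) (*-cong (sin-co y) (sin-neg x)) ⟩
    sin y * cos x + cos y * - sin x                  ≈⟨ solve 4 (λ sy cx cy sx → sy :* cx :+ cy :* (:- sx) := sy :* cx :- cy :* sx) refl (sin y) (cos x) (cos y) (sin x) ⟩
    sin y * cos x - cos y * sin x                    ∎

  sin-sub-π : ∀ x → sin (x - π) ≈ - sin x
  sin-sub-π x = begin
    sin (x - π)                    ≈⟨ sin-sub π x ⟩
    sin x * cos π - cos x * sin π  ≈⟨ +-cong (*-congˡ cos-π) (-‿cong (*-congˡ sin-π)) ⟩
    sin x * - 1# - cos x * 0#      ≈⟨ solve 2 (λ s k → s :* (:- con (+ 1)) :- k :* con (+ 0) := :- s) refl (sin x) (cos x) ⟩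
    - sin x                        ∎

  sin-add-π : ∀ x → sin (x + π) ≈ - sin x
  sin-add-π x = begin
    sin (x + π)            ≈⟨ -‿involutive _ ⟨
    - - sin (x + π)        ≈⟨ -‿cong (sin-sub-π (x + π)) ⟨
    - sin ((x + π) - π)    ≈⟨ -‿cong (sin-cong (solve 2 (λ x p → (x :+ p) :- p := x) refl x π)) ⟩
    - sin x                ∎

  sin-add-2π : ∀ x → sin (x + 2π) ≈ sin x
  sin-add-2π x = begin
    sin (x + 2π)       ≈⟨ sin-cong (+-assoc x π π) ⟨
    sin ((x + π) + π)  ≈⟨ sin-add-π (x + π) ⟩
    - sin (x + π)      ≈⟨ -‿cong (sin-add-π x) ⟩
    - - sin x          ≈⟨ -‿involutive _ ⟩
    sin x              ∎

  cos-add-π : ∀ x → cos (x + π) ≈ - cos x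
  cos-add-π x = begin
    cos (x + π)          ≈⟨ sin-co (x + π) ⟨
    sin (½π - (x + π))   ≈⟨ sin-cong (solve 3 (λ h x p → h :- (x :+ p) := (h :- x) :- p) refl ½π x π) ⟩
    sin ((½π - x) - π)   ≈⟨ sin-sub-π (½π - x) ⟩
    - sin (½π - x)       ≈⟨ -‿cong (sin-co x) ⟩
    - cos x              ∎

  -- `sin x` is the cosine of the distance from `x` to `½π`, and that distance is below `½π`. The
  -- midpoint is separate because `cos-pos` requires a positive argument.
  sin-pos : ∀ {x} → 0# < x → x < π → 0# < sin x
  sin-pos {x} 0<x x<π with ≤-or-> x ½π
  ... | inj₂ ½π<x = <-respʳ-≈ (trans (sym (cos-neg (x - ½π)))
          (trans (cos-cong (solve 2 (λ x h → :- (x :- h) := h :- x) refl x ½π)) (cos-co x)))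
          (cos-pos (<-by ½π<x (solve 2 (λ x h → x :- h := (x :- h) :- con (+ 0)) refl x ½π))
                   (<-by x<π (solve 2 (λ x h → (h :+ h) :- x := h :- (x :- h)) refl x ½π)))
  ... | inj₁ x≤½π with ≤⇒<-or-≈ x≤½π
  ...   | inj₂ x≈½π = <-respʳ-≈ (sym (trans (sin-cong x≈½π) sin-½π)) 0<1
  ...   | inj₁ x<½π = <-respʳ-≈ (cos-co x)
          (cos-pos (<-by x<½π (solve 2 (λ x h → h :- x := (h :- x) :- con (+ 0)) refl x ½π))
                   (<-by 0<x (solve 2 (λ x h → x :- con (+ 0) := h :- (h :- x)) refl x ½π)))

  sin-nonneg : ∀ {x} → 0# ≤ x → x ≤ π → 0# ≤ sin x
  sin-nonneg 0≤x x≤π with ≤⇒<-or-≈ 0≤x | ≤⇒<-or-≈ x≤π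
  ... | inj₂ 0≈x | _        = ≤-reflexive (trans (sym sin-0) (sin-cong 0≈x))
  ... | inj₁ _   | inj₂ x≈π = ≤-reflexive (trans (sym sin-π) (sin-cong (sym x≈π)))
  ... | inj₁ 0<x | inj₁ x<π = proj₁ (sin-pos 0<x x<π)

  sin-nonpos : ∀ {x} → - π ≤ x → x ≤ 0# → sin x ≤ 0#
  sin-nonpos {x} -π≤x x≤0 = 0≤-⇒≤0 (≤-respʳ-≈ (sin-neg x) (sin-nonneg (≤0⇒0≤- x≤0)
    (≤-by -π≤x (solve 2 (λ x p → x :- (:- p) := p :- (:- x)) refl x π))))

  sin-neg< : ∀ {x} → - π < x → x < 0# → sin x < 0#
  sin-neg< {x} -π<x x<0 = <-by (<-respʳ-≈ (sin-neg x) (sin-pos (<0⇒0<- x<0)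
    (<-by -π<x (solve 2 (λ x p → x :- (:- p) := p :- (:- x)) refl x π))))
    (solve 1 (λ s → (:- s) :- con (+ 0) := con (+ 0) :- s) refl (sin x))

  -- The range is that of a difference of two angles in `[0, 2π)`, so three multiples of `π` remain.
  sin≈0⇒ : ∀ {x} → - 2π < x → x < 2π → sin x ≈ 0# → x ≈ 0# ⊎ x ≈ π ⊎ x ≈ - π
  sin≈0⇒ {x} -2π<x x<2π s≈0 with ≤-or-> x 0#
  ... | inj₂ 0<x with ≤-or-> x π
  ...   | inj₂ π<x = contradiction
          (trans (sin-sub-π x) (trans (-‿cong s≈0) -0#≈0#))
          (0<⇒≉0 (sin-pos (<-by π<x (solve 2 (λ x p → x :- p := (x :- p) :- con (+ 0)) refl x π))
                          (<-by x<2π (solve 2 (λ x p → (p :+ p) :- x := p :- (x :- p)) refl x π))))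
  ...   | inj₁ x≤π with ≤⇒<-or-≈ x≤π
  ...     | inj₁ x<π = contradiction s≈0 (0<⇒≉0 (sin-pos 0<x x<π))
  ...     | inj₂ x≈π = inj₂ (inj₁ x≈π)
  sin≈0⇒ {x} -2π<x x<2π s≈0 | inj₁ x≤0 with ≤⇒<-or-≈ x≤0
  ... | inj₂ x≈0 = inj₁ x≈0
  ... | inj₁ x<0 with ≤-or-> (- π) x
  ...   | inj₁ -π≤x with ≤⇒<-or-≈ -π≤x
  ...     | inj₁ -π<x = contradiction s≈0 (proj₂ (sin-neg< -π<x x<0))
  ...     | inj₂ -π≈x = inj₂ (inj₂ (sym -π≈x))
  sin≈0⇒ {x} -2π<x x<2π s≈0 | inj₁ x≤0 | inj₁ x<0 | inj₂ x<-π = contradiction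
    (trans (sin-add-π x) (trans (-‿cong s≈0) -0#≈0#))
    (proj₂ (sin-neg< (<-by -2π<x (solve 2 (λ x p → x :- (:- (p :+ p)) := (x :+ p) :- (:- p)) refl x π))
                     (<-by x<-π (solve 2 (λ x p → (:- p) :- x := con (+ 0) :- (x :+ p)) refl x π))))

  -- Modulo a full turn the two alternatives are one arc: since `x < 2π`, subtracting `2π` in the
  -- second one lands in `[-π, 0)`.
  sin≤0⇒ : ∀ {x} → - 2π < x → x < 2π → sin x ≤ 0# → (- π ≤ x × x ≤ 0#) ⊎ (π ≤ x)
  sin≤0⇒ {x} -2π<x x<2π s≤0 with ≤-or-> x 0#
  ... | inj₂ 0<x with ≤-or-> π x
  ...   | inj₁ π≤x = inj₂ π≤x
  ...   | inj₂ x<π = contradiction (sin-pos 0<x x<π) (≤⇒≯ s≤0)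
  sin≤0⇒ {x} -2π<x x<2π s≤0 | inj₁ x≤0 with ≤-or-> (- π) x
  ... | inj₁ -π≤x = inj₁ (-π≤x , x≤0)
  ... | inj₂ x<-π = contradiction
    (<-respʳ-≈ (sin-add-2π x) (sin-pos
      (<-by -2π<x (solve 2 (λ x p → x :- (:- (p :+ p)) := (x :+ (p :+ p)) :- con (+ 0)) refl x π))
      (<-by x<-π (solve 2 (λ x p → (:- p) :- x := p :- (x :+ (p :+ p))) refl x π))))
    (≤⇒≯ s≤0)

  -- Motion driven by a sine, and its behaviour over one turn.

  -- Of the rate only the sign is kept, because one and the same step is described by two sines,
  -- taken relative to the composites before and after it, with different rates.
  record PushedBack (s B B′ : Carrier) : Set (c Level.⊔ ℓ) where
    constructor pushed
    field
      {rate} : Carrier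
      0<rate : 0# < rate
      moved  : B′ ≈ B - rate * s

  module _ {s B B′} (P : PushedBack s B B′) where
    open PushedBack P renaming (rate to p; 0<rate to 0<p; moved to B′≈)

    falls< : 0# < s → B′ < B
    falls< 0<s = <-by (*-pos 0<p 0<s) (begin
      p * s - 0#       ≈⟨ solve 3 (λ B p s → p :* s :- con (+ 0) := B :- (B :- p :* s)) refl B p s ⟩
      B - (B - p * s)  ≈⟨ +-congˡ (-‿cong B′≈) ⟨
      B - B′           ∎)

    falls : 0# ≤ s → B′ ≤ B
    falls 0≤s = ≤-by (*-nonneg (proj₁ 0<p) 0≤s) (begin
      p * s - 0#       ≈⟨ solve 3 (λ B p s → p :* s :- con (+ 0) := B :- (B :- p :* s)) refl B p s ⟩
      B - (B - p * s)  ≈⟨ +-congˡ (-‿cong B′≈) ⟨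
      B - B′           ∎)

    flat : B′ ≈ B → s ≈ 0#
    flat B′≈B = *-cancelˡ-0 (0<⇒≉0 0<p) (begin
      p * s            ≈⟨ solve 3 (λ B p s → p :* s := B :- (B :- p :* s)) refl B p s ⟩
      B - (B - p * s)  ≈⟨ +-congˡ (-‿cong (trans (sym B′≈) B′≈B)) ⟩
      B - B            ≈⟨ -‿inverseʳ B ⟩
      0#               ∎)

    pushed-neg : ∀ {s′} → s′ ≈ - s → PushedBack s′ (- B) (- B′)
    pushed-neg {s′} s′≈ = pushed 0<p (begin
      - B′                 ≈⟨ -‿cong B′≈ ⟩
      - (B - p * s)        ≈⟨ solve 3 (λ B p s → :- (B :- p :* s) := (:- B) :- p :* (:- s)) refl B p s ⟩
      - B - p * - s        ≈⟨ +-congˡ (-‿cong (*-congˡ s′≈)) ⟨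
      - B - p * s′         ∎)

    pushed-cong : ∀ {s′} → s′ ≈ s → PushedBack s′ B B′
    pushed-cong s′≈ = pushed 0<p (trans B′≈ (+-congˡ (-‿cong (*-congˡ (sym s′≈)))))

  module _ {s B B′} (P : PushedBack s B B′) where

    rises : s ≤ 0# → B ≤ B′
    rises s≤0 = neg-≤⁻¹ (falls (pushed-neg P refl) (≤0⇒0≤- s≤0))

    rises< : s < 0# → B < B′
    rises< s<0 = rises (proj₁ s<0) , λ B≈B′ → proj₂ s<0 (flat P (sym B≈B′))

  -- In the application u j is the angle from the j-th composite to the j-th
  -- function, v j the angle from the (j+1)-st composite to the same function,
  -- and B j the intercept of the j-th composite.
  record Frame (n : ℕ) (u v B : ℕ → Carrier) : Set (c Level.⊔ ℓ) where
    field
      near₁   : ∀ j → v j < u j + π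
      near₂   : ∀ j → u j < v j + π
      step₁   : ∀ j → PushedBack (sin (u j)) (B j) (B (suc j))
      step₂   : ∀ j → PushedBack (sin (v j)) (B j) (B (suc j))
      advance : ∀ j → v j ≤ u (suc j)
      turn    : ∀ j → u (n ℕ.+ j) ≈ u j + 2π
      closed  : ∀ j → B (n ℕ.+ j) ≈ B j

  open Frame

  module _ {n u v B} (F : Frame n u v B) (w : Carrier) where

    private
      near-shift : ∀ {x y} → x < y + π → x + w < (y + w) + π
      near-shift {x} {y} p = <-by p (solve 4 (λ x y w p → (y :+ p) :- x := ((y :+ w) :+ p) :- (x :+ w)) refl x y w π)

      turn-shift : ∀ j → u (n ℕ.+ j) + w ≈ (u j + w) + 2π
      turn-shift j = trans (+-congʳ (turn F j)) (solve 3 (λ u w p → (u :+ p) :+ w := (u :+ w) :+ p) refl (u j) w 2π)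

    translate : (∀ x → sin (x + w) ≈ sin x) → Frame n (λ j → u j + w) (λ j → v j + w) B
    translate period = record
      { near₁   = λ j → near-shift (near₁ F j)
      ; near₂   = λ j → near-shift (near₂ F j)
      ; step₁   = λ j → pushed-cong (step₁ F j) (period (u j))
      ; step₂   = λ j → pushed-cong (step₂ F j) (period (v j))
      ; advance = λ j → +-mono-≤ w (advance F j)
      ; turn    = turn-shift
      ; closed  = closed F
      }

    -- A half turn negates the sines and so exchanges rising with falling. Facts about the multiple
    -- `0` of `π` and about maxima thereby become facts about `π` and `-π` and about minima.
    flip : (∀ x → sin (x + w) ≈ - sin x) → Frame n (λ j → u j + w) (λ j → v j + w) (λ j → - B j)
    flip antiperiod = record
      { near₁   = λ j → near-shift (near₁ F j)
      ; near₂   = λ j → near-shift (near₂ F j)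
      ; step₁   = λ j → pushed-neg (step₁ F j) (antiperiod (u j))
      ; step₂   = λ j → pushed-neg (step₂ F j) (antiperiod (v j))
      ; advance = λ j → +-mono-≤ w (advance F j)
      ; turn    = turn-shift
      ; closed  = λ j → -‿cong (closed F j)
      }

  -- If u and v were on different sides of 0, then, being less than π apart,
  -- their sines would have opposite signs, but they push B the same way.
  module _ {n u v B} (F : Frame n u v B) where

    stays-pos : ∀ j → 0# < u j → 0# < u (suc j)
    stays-pos j 0<u with ≤-or-> (v j) 0#
    ... | inj₂ 0<v = <-≤-trans 0<v (advance F j)
    ... | inj₁ v≤0 = contradiction
      (falls< (step₁ F j) (sin-pos 0<u (<-≤-trans (near₂ F j)
        (≤-by v≤0 (solve 2 (λ v p → con (+ 0) :- v := p :- (v :+ p)) refl (v j) π)))))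
      (≤⇒≯ (rises (step₂ F j) (sin-nonpos (proj₁ (<-trans
        (<-by 0<u (solve 2 (λ u p → u :- con (+ 0) := (u :- p) :- (:- p)) refl (u j) π))
        (<-by (near₂ F j) (solve 3 (λ u v p → (v :+ p) :- u := v :- (u :- p)) refl (u j) (v j) π)))) v≤0)))

    stays-nonneg : ∀ j → 0# ≤ u j → 0# ≤ u (suc j)
    stays-nonneg j 0≤u with ≤-or-> 0# (v j)
    ... | inj₁ 0≤v = ≤-trans 0≤v (advance F j)
    ... | inj₂ v<0 = contradiction
      (rises< (step₂ F j) (sin-neg< (≤-<-trans
        (≤-by 0≤u (solve 2 (λ u p → u :- con (+ 0) := (u :- p) :- (:- p)) refl (u j) π))
        (<-by (near₂ F j) (solve 3 (λ u v p → (v :+ p) :- u := v :- (u :- p)) refl (u j) (v j) π))) v<0))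
      (≤⇒≯ (falls (step₁ F j) (sin-nonneg 0≤u (proj₁ (<-trans (near₂ F j)
        (<-by v<0 (solve 2 (λ v p → con (+ 0) :- v := p :- (v :+ p)) refl (v j) π)))))))

    pos-persists : ∀ m {j} → 0# < u j → 0# < u (m ℕ.+ j)
    pos-persists zero    p = p
    pos-persists (suc m) p = stays-pos _ (pos-persists m p)

    nonneg-persists : ∀ m {j} → 0# ≤ u j → 0# ≤ u (m ℕ.+ j)
    nonneg-persists zero    p = p
    nonneg-persists (suc m) p = stays-nonneg _ (nonneg-persists m p)

  module _ {n u v B} (F : Frame n u v B) where

    private
      F₊ : Frame n (λ j → u j + π) (λ j → v j + π) (λ j → - B j)
      F₊ = flip F π sin-add-π

      F₋ : Frame n (λ j → u j - π) (λ j → v j - π) (λ j → - B j)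
      F₋ = flip F (- π) sin-sub-π

      F₋₋ : Frame n (λ j → (u j - π) - π) (λ j → (v j - π) - π) (λ j → - - B j)
      F₋₋ = flip F₋ (- π) sin-sub-π

    ≥-π-persists : ∀ m {j} → - π ≤ u j → - π ≤ u (m ℕ.+ j)
    ≥-π-persists m {j} p = ≤-by
      (nonneg-persists F₊ m (≤-by p (solve 2 (λ u p → u :- (:- p) := (u :+ p) :- con (+ 0)) refl (u j) π)))
      (solve 2 (λ u p → (u :+ p) :- con (+ 0) := u :- (:- p)) refl (u (m ℕ.+ j)) π)

    ≥π-persists : ∀ m {j} → π ≤ u j → π ≤ u (m ℕ.+ j)
    ≥π-persists m {j} p = ≤-by
      (nonneg-persists F₋ m (≤-by p (solve 2 (λ u p → u :- p := (u :- p) :- con (+ 0)) refl (u j) π)))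
      (solve 2 (λ u p → (u :- p) :- con (+ 0) := u :- p) refl (u (m ℕ.+ j)) π)

    -- The contrapositive of persistence: an angle above `2π` is still positive after two half turns
    -- back, and it would remain so.
    ≤2π-before : ∀ m {j} → u (m ℕ.+ j) ≤ 2π → u j ≤ 2π
    ≤2π-before m {j} p with ≤-or-> (u j) 2π
    ... | inj₁ u≤2π = u≤2π
    ... | inj₂ 2π<u = contradiction
      (<-by (pos-persists F₋₋ m (<-by 2π<u (solve 2 (λ u p → u :- (p :+ p) := ((u :- p) :- p) :- con (+ 0)) refl (u j) π)))
            (solve 2 (λ u p → ((u :- p) :- p) :- con (+ 0) := u :- (p :+ p)) refl (u (m ℕ.+ j)) π))
      (≤⇒≯ p)

    rises-on-[-π,0] : ∀ {j} → - π ≤ u j → u j ≤ 0# → B j ≤ B (suc j)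
    rises-on-[-π,0] p q = rises (step₁ F _) (sin-nonpos p q)

    falls-on-[0,π] : ∀ {j} → 0# ≤ u j → u j ≤ π → B (suc j) ≤ B j
    falls-on-[0,π] p q = falls (step₁ F _) (sin-nonneg p q)

    rises-on-[π,2π] : ∀ {j} → π ≤ u j → u j ≤ 2π → B j ≤ B (suc j)
    rises-on-[π,2π] {j} p q = neg-≤⁻¹ (falls (step₁ F₋ j) (sin-nonneg
      (≤-by p (solve 2 (λ u p → u :- p := (u :- p) :- con (+ 0)) refl (u j) π))
      (≤-by q (solve 2 (λ u p → (p :+ p) :- u := p :- (u :- p)) refl (u j) π))))

    -- The lower bound on the angle is asked for only at the first index and the upper bound only at
    -- the last; persistence and its contrapositive spread them over the steps between. The same
    -- holds for `falls-before-π`.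
    rises-after-π : ∀ m {j} → u (m ℕ.+ j) ≤ 2π → π ≤ u j → B j ≤ B (m ℕ.+ j)
    rises-after-π zero    _    _   = ≤-refl
    rises-after-π (suc m) {j} u≤2π π≤u = ≤-trans (rises-after-π m um≤2π π≤u)
      (rises-on-[π,2π] (≥π-persists m π≤u) um≤2π)
      where
      um≤2π : u (m ℕ.+ j) ≤ 2π
      um≤2π = ≤2π-before 1 u≤2π

    ≤π-before : ∀ m {j} → u (m ℕ.+ j) ≤ π → u j ≤ π
    ≤π-before m {j} p with ≤-or-> (u j) π
    ... | inj₁ u≤π = u≤π
    ... | inj₂ π<u = contradiction
      (<-by (pos-persists F₋ m (<-by π<u (solve 2 (λ u p → u :- p := (u :- p) :- con (+ 0)) refl (u j) π)))
            (solve 2 (λ u p → (u :- p) :- con (+ 0) := u :- p) refl (u (m ℕ.+ j)) π))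
      (≤⇒≯ p)

    falls-before-π : ∀ m {j} → 0# ≤ u j → u (m ℕ.+ j) ≤ π → B (m ℕ.+ j) ≤ B j
    falls-before-π zero        _   _   = ≤-refl
    falls-before-π (suc m) {j} 0≤u u≤π = ≤-trans
      (falls-on-[0,π] (nonneg-persists F m 0≤u) um≤π) (falls-before-π m 0≤u um≤π)
      where
      um≤π : u (m ℕ.+ j) ≤ π
      um≤π = ≤π-before 1 u≤π

    turn-from : ∀ {m i} → m ℕ.≤ n → u ((n ℕ.∸ m) ℕ.+ (m ℕ.+ i)) ≈ u i + 2π
    turn-from {m} {i} m≤n = trans (reflexive (≡.cong u (remaining m≤n i))) (turn F i)

    closed-from : ∀ {m i} → m ℕ.≤ n → B ((n ℕ.∸ m) ℕ.+ (m ℕ.+ i)) ≈ B i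
    closed-from {m} {i} m≤n = trans (reflexive (≡.cong B (remaining m≤n i))) (closed F i)

  -- While the angle is at most `π`, the intercept has only fallen since `i`. Once the angle is past
  -- `π`, the intercept can only rise until the turn closes at angle `2π`, where it is `B i` again.
  peak : ∀ {n u v B} → Frame n u v B → ∀ {i} → u i ≈ 0# → ∀ {m} → m ℕ.≤ n → B (m ℕ.+ i) ≤ B i
  peak {n} {u} {v} {B} F {i} u≈0 {m} m≤n with ≤-or-> (u (m ℕ.+ i)) π
  ... | inj₁ u≤π = falls-before-π F m (≤-reflexive (sym u≈0)) u≤π
  ... | inj₂ π<u = ≤-respʳ-≈ (closed-from F m≤n) (rises-after-π F (n ℕ.∸ m)
          (≤-reflexive (trans (turn-from F m≤n) (trans (+-congʳ u≈0) (+-identityˡ 2π)))) (proj₁ π<u))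

  -- `w` is a parameter because the opposite direction appears as a difference of `π` or of `-π`.
  trough : ∀ {n u v B} → Frame n u v B → ∀ w → (∀ x → sin (x + w) ≈ - sin x) →
           ∀ {i} → u i + w ≈ 0# → ∀ {m} → m ℕ.≤ n → B i ≤ B (m ℕ.+ i)
  trough F w antiperiod u+w≈0 m≤n = neg-≤⁻¹ (peak (flip F w antiperiod) u+w≈0 m≤n)

  UnimodalFrom : ℕ → (ℕ → Carrier) → ℕ → Set ℓ
  UnimodalFrom n B i = ∃[ l ] l ℕ.≤ n
    × (∀ {m} → m ℕ.< l → B (m ℕ.+ i) ≤ B (suc m ℕ.+ i))
    × (∀ {m} → l ℕ.≤ m → m ℕ.< n → B (suc m ℕ.+ i) ≤ B (m ℕ.+ i))

  module _ {n u v B} (F : Frame n u v B) where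

    ascent-then-descent : ∀ {i} → - π ≤ u i → u i ≤ 0# → (∀ m → B i ≤ B (m ℕ.+ i)) → UnimodalFrom n B i
    ascent-then-descent {i} -π≤u u≤0 min
      with l , l≤n , before , after ← crossing (λ m → 0# < u (m ℕ.+ i))
             (λ m → <-decide 0# (u (m ℕ.+ i))) (λ m → stays-pos F (m ℕ.+ i)) n
      = l , l≤n , up , down
      where
      up : ∀ {m} → m ℕ.< l → B (m ℕ.+ i) ≤ B (suc m ℕ.+ i)
      up {m} m<l = rises-on-[-π,0] F (≥-π-persists F m -π≤u) (≮⇒≥ (before m<l))
      down : ∀ {m} → l ℕ.≤ m → m ℕ.< n → B (suc m ℕ.+ i) ≤ B (m ℕ.+ i)
      down {m} l≤m m<n with ≤-or-> (u (m ℕ.+ i)) π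
      ... | inj₁ u≤π = falls-on-[0,π] F (proj₁ (after l≤m m<n)) u≤π
      -- The intercept rises from `suc m` to the end of the turn, where it equals the minimum `B i`;
      -- so it is at most `B i` at `suc m`, and `B i` is at most its value at `m`.
      ... | inj₂ π<u = ≤-trans (≤-respʳ-≈ (closed-from F m<n) (rises-after-π F (n ℕ.∸ suc m) u≤2π
                         (≥π-persists F 1 (proj₁ π<u)))) (min m)
        where
        u≤2π : u ((n ℕ.∸ suc m) ℕ.+ (suc m ℕ.+ i)) ≤ 2π
        u≤2π = ≤-respˡ-≈ (sym (turn-from F m<n))
          (≤-by u≤0 (solve 2 (λ u p → con (+ 0) :- u := p :- (u :+ p)) refl (u i) 2π))

-- Polar angles lifted along the cycle.

module Lifting {c ℓ} (R : Reals c ℓ) (T : Trigonometry R) where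
  open Angles R T public
  open SetoidReasoning setoid

  cross-product : ∀ {x y t X Y φ} → IsPolarAngle x y t → IsPolarAngle X Y φ →
                  ∃[ p ] 0# < p × x * Y - y * X ≈ - (p * sin (t - φ))
  cross-product {x} {y} {t} {X} {Y} {φ} (_ , _ , r , 0<r , x≈ , y≈) (_ , _ , s , 0<s , X≈ , Y≈) =
    r * s , *-pos 0<r 0<s , (begin
      x * Y - y * X                                              ≈⟨ +-cong (*-cong x≈ Y≈) (-‿cong (*-cong y≈ X≈)) ⟩
      (r * cos t) * (s * sin φ) - (r * sin t) * (s * cos φ)      ≈⟨ +-cong (interchange (cos t) (sin φ)) (-‿cong (interchange (sin t) (cos φ))) ⟩
      (r * s) * (cos t * sin φ) - (r * s) * (sin t * cos φ)      ≈⟨ solve 3 (λ p x y → p :* x :- p :* y := :- (p :* (y :- x))) refl (r * s) (cos t * sin φ) (sin t * cos φ) ⟩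
      - ((r * s) * (sin t * cos φ - cos t * sin φ))              ≈⟨ -‿cong (*-congˡ (sin-sub φ t)) ⟨
      - ((r * s) * sin (t - φ))                                  ∎)
    where
    interchange : ∀ x y → (r * x) * (s * y) ≈ (r * s) * (x * y)
    interchange x y = solve 4 (λ r s x y → (r :* x) :* (s :* y) := (r :* s) :* (x :* y)) refl r s x y

  inverse-pos : ∀ {x} → 0# < x → ∃[ y ] 0# < y × x * y ≈ 1#
  inverse-pos {x} 0<x with inverse x (0<⇒≉0 0<x)
  ... | y , xy≈1 = y , ≰⇒> y≰0 , xy≈1
    where
    y≰0 : ¬ (y ≤ 0#)
    y≰0 y≤0 = ≤⇒≯ (0≤-⇒≤0 (≤-respʳ-≈ (begin
      x * - y    ≈⟨ -‿distribʳ-* x y ⟨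
      - (x * y)  ≈⟨ -‿cong xy≈1 ⟩
      - 1#       ∎) (*-nonneg (proj₁ 0<x) (≤0⇒0≤- y≤0)))) 0<1

  *-posˡ-<0 : ∀ {x y} → 0# < x → y < 0# → x * y < 0#
  *-posˡ-<0 {x} {y} 0<x y<0 = <-by (*-pos 0<x (<0⇒0<- y<0))
    (solve 2 (λ x y → x :* (:- y) :- con (+ 0) := con (+ 0) :- x :* y) refl x y)

  -- If `φ + π ≤ φ′`, then `φ < π` forces `Y` to be nonnegative and `π ≤ φ′` forces it to be
  -- nonpositive. Hence `Y` vanishes, the angles are exactly `0` and `π`, and the two vectors are
  -- opposite.
  less-than-half-turn : ∀ {X X′ Y φ φ′} → IsPolarAngle X Y φ → IsPolarAngle X′ Y φ′ →
    (Y ≈ 0# → ¬ (0# < X × X′ < 0#)) → φ′ < φ + π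
  less-than-half-turn {X} {X′} {Y} {φ} {φ′}
    (0≤φ , φ<2π , r , 0<r , X≈ , Y≈) (0≤φ′ , φ′<2π , r′ , 0<r′ , X′≈ , Y≈′) ¬opposite
    with ≤-or-> (φ + π) φ′
  ... | inj₂ φ′<φ+π = φ′<φ+π
  ... | inj₁ φ+π≤φ′ = contradiction (0<X , X′<0) (¬opposite Y≈0)
    where
    φ<π : φ < π
    φ<π = ≤-<-trans (≤-by φ+π≤φ′ (solve 3 (λ a b p → b :- (a :+ p) := (b :- p) :- a) refl φ φ′ π))
                    (<-by φ′<2π (solve 2 (λ b p → (p :+ p) :- b := p :- (b :- p)) refl φ′ π))
    π≤φ′ : π ≤ φ′
    π≤φ′ = ≤-trans (≤-by 0≤φ (solve 2 (λ a p → a :- con (+ 0) := (a :+ p) :- p) refl φ π)) φ+π≤φ′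
    ψ = φ′ - π
    0≤ψ : 0# ≤ ψ
    0≤ψ = ≤-by π≤φ′ (solve 2 (λ b p → b :- p := (b :- p) :- con (+ 0)) refl φ′ π)
    ψ<π : ψ < π
    ψ<π = <-by φ′<2π (solve 2 (λ b p → (p :+ p) :- b := p :- (b :- p)) refl φ′ π)
    0≤Y : 0# ≤ Y
    0≤Y = ≤-respʳ-≈ (sym Y≈) (*-nonneg (proj₁ 0<r) (sin-nonneg 0≤φ (proj₁ φ<π)))
    -Y≈ : - Y ≈ r′ * sin ψ
    -Y≈ = begin
      - Y              ≈⟨ -‿cong Y≈′ ⟩
      - (r′ * sin φ′)  ≈⟨ -‿distribʳ-* r′ (sin φ′) ⟩
      r′ * - sin φ′    ≈⟨ *-congˡ (sin-sub-π φ′) ⟨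
      r′ * sin ψ       ∎
    Y≤0 : Y ≤ 0#
    Y≤0 = 0≤-⇒≤0 (≤-respʳ-≈ (sym -Y≈) (*-nonneg (proj₁ 0<r′) (sin-nonneg 0≤ψ (proj₁ ψ<π))))
    Y≈0 : Y ≈ 0#
    Y≈0 = antisym Y≤0 0≤Y
    zero-angle : ∀ {x} → 0# ≤ x → x < π → sin x ≈ 0# → x ≈ 0#
    zero-angle 0≤x x<π s≈0 with ≤⇒<-or-≈ 0≤x
    ... | inj₁ 0<x = contradiction s≈0 (0<⇒≉0 (sin-pos 0<x x<π))
    ... | inj₂ 0≈x = sym 0≈x
    φ≈0 : φ ≈ 0#
    φ≈0 = zero-angle 0≤φ φ<π (*-cancelˡ-0 (0<⇒≉0 0<r) (trans (sym Y≈) Y≈0))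
    ψ≈0 : ψ ≈ 0#
    ψ≈0 = zero-angle 0≤ψ ψ<π (*-cancelˡ-0 (0<⇒≉0 0<r′) (trans (sym -Y≈) (trans (-‿cong Y≈0) -0#≈0#)))
    0<X : 0# < X
    0<X = <-respʳ-≈ (sym (begin
      X          ≈⟨ X≈ ⟩
      r * cos φ  ≈⟨ *-congˡ (trans (cos-cong φ≈0) cos-0) ⟩
      r * 1#     ≈⟨ *-identityʳ r ⟩
      r          ∎)) 0<r
    X′≈-r′ : X′ ≈ r′ * - 1#
    X′≈-r′ = begin
      X′                ≈⟨ X′≈ ⟩
      r′ * cos φ′       ≈⟨ *-congˡ (cos-cong (solve 2 (λ b p → b := (b :- p) :+ p) refl φ′ π)) ⟩
      r′ * cos (ψ + π)  ≈⟨ *-congˡ (cos-add-π ψ) ⟩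
      r′ * - cos ψ      ≈⟨ *-congˡ (-‿cong (trans (cos-cong ψ≈0) cos-0)) ⟩
      r′ * - 1#         ∎
    X′<0 : X′ < 0#
    X′<0 = <-respˡ-≈ (sym X′≈-r′) (<-by 0<r′
      (solve 1 (λ r → r :- con (+ 0) := con (+ 0) :- r :* (:- con (+ 1))) refl r′))

  sin-add-×2π : ∀ m x → sin (x + m ×ᴿ 2π) ≈ sin x
  sin-add-×2π zero    x = sin-cong (+-identityʳ x)
  sin-add-×2π (suc m) x = begin
    sin (x + suc m ×ᴿ 2π)      ≈⟨ sin-cong (+-congˡ (1+× m 2π)) ⟩
    sin (x + (2π + m ×ᴿ 2π))   ≈⟨ sin-cong (solve 3 (λ x p q → x :+ (p :+ q) := (x :+ q) :+ p) refl x 2π (m ×ᴿ 2π)) ⟩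
    sin ((x + m ×ᴿ 2π) + 2π)   ≈⟨ sin-add-2π (x + m ×ᴿ 2π) ⟩
    sin (x + m ×ᴿ 2π)          ≈⟨ sin-add-×2π m x ⟩
    sin x                      ∎

  sin-sub-×2π : ∀ m x → sin (x - m ×ᴿ 2π) ≈ sin x
  sin-sub-×2π m x = trans (sym (sin-add-×2π m (x - m ×ᴿ 2π)))
    (sin-cong (solve 2 (λ x p → (x :- p) :+ p := x) refl x (m ×ᴿ 2π)))

  sin-turned : ∀ m x y → sin ((x + m ×ᴿ 2π) - y) ≈ sin (x - y)
  sin-turned m x y = trans
    (sin-cong (solve 3 (λ x q y → (x :+ q) :- y := (x :- y) :+ q) refl x (m ×ᴿ 2π) y))
    (sin-add-×2π m (x - y))

  -- When `D` vanishes, the composites are translations, and conjugating a translation by a linear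
  -- function scales it by the slope.
  drift-horizontal : ∀ {a b B B′ D} → D ≈ 0# → B′ ≈ B + (b * D - (1# - a) * B) → B′ ≈ a * B
  drift-horizontal {a} {b} {B} {B′} {D} D≈0 B′≈ = begin
    B′                             ≈⟨ B′≈ ⟩
    B + (b * D - (1# - a) * B)     ≈⟨ +-congˡ (+-congʳ (*-congˡ D≈0)) ⟩
    B + (b * 0# - (1# - a) * B)    ≈⟨ solve 3 (λ a b B → B :+ (b :* con (+ 0) :- (con (+ 1) :- a) :* B) := a :* B) refl a b B ⟩
    a * B                          ∎

  -- The vectors (b j , 1 - a j) and (B j , D) are those of the j-th function
  -- and of the j-th composite; drift is their cross product.
  record CyclicDrift (n : ℕ) .{{_ : NonZero n}} (a b B ang φ : ℕ → Carrier) (D : Carrier) : Set (c Level.⊔ ℓ) where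
    field
      0<a     : ∀ j → 0# < a j
      drift   : ∀ j → B (suc j) ≈ B j + (b j * D - (1# - a j) * B j)
      polar-f : ∀ j → IsPolarAngle (b j) (1# - a j) (ang j)
      polar-F : ∀ j → IsPolarAngle (B j) D (φ j)
      cyclicᵃ : ∀ j → ang (n ℕ.+ j) ≈ ang j
      cyclicᵠ : ∀ j → φ (n ℕ.+ j) ≈ φ j
      cyclicᴮ : ∀ j → B (n ℕ.+ j) ≈ B j
      cut     : ℕ
      sorted  : ∀ j → suc ((cut ℕ.+ j) % n) ℕ.< n → ang j ≤ ang (suc j)

  module _ {n : ℕ} .{{_ : NonZero n}} {a b B ang φ D} (C : CyclicDrift n a b B ang φ D) where
    open CyclicDrift C

    private
      -- A full turn for each completed pass through the sorted list of angles; `cut + j` counts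
      -- places from the start of that list.
      turns : ℕ → Carrier
      turns j = ((cut ℕ.+ j) / n) ×ᴿ 2π

      t u v : ℕ → Carrier
      t j = ang j + turns j
      u j = t j - φ j
      v j = t j - φ (suc j)

      t-mono : ∀ j → t j ≤ t (suc j)
      t-mono j with suc-%-/ {n} (cut ℕ.+ j)
      ... | inj₁ (r<n , q) = ≤-add (sorted j r<n)
              (≤-reflexive (reflexive (≡.cong (_×ᴿ 2π) (≡.sym (≡.trans (≡.cong (_/ n) (ℕₚ.+-suc cut j)) q)))))
      -- At the seam the angle may drop, but by less than the full turn that is added, since both
      -- angles lie in `[0, 2π)`.
      ... | inj₂ q = ≤-respʳ-≈ (+-congˡ (sym turns-suc)) (≤-by
              (≤-add (proj₁ (proj₁ (proj₂ (polar-f j)))) (proj₁ (polar-f (suc j))))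
              (solve 4 (λ x y p q → (p :+ y) :- (x :+ con (+ 0)) := (y :+ (p :+ q)) :- (x :+ q)) refl (ang j) (ang (suc j)) 2π (turns j)))
        where
        turns-suc : turns (suc j) ≈ 2π + turns j
        turns-suc = trans (reflexive (≡.cong (_×ᴿ 2π) (≡.trans (≡.cong (_/ n) (ℕₚ.+-suc cut j)) q)))
                          (1+× ((cut ℕ.+ j) / n) 2π)

      turns-n : ∀ j → turns (n ℕ.+ j) ≈ 2π + turns j
      turns-n j = trans (reflexive (≡.cong (_×ᴿ 2π) (≡.trans (≡.cong (_/ n) swap) ([n+m]/n≡1+m/n (cut ℕ.+ j)))))
                        (1+× ((cut ℕ.+ j) / n) 2π)
        where
        swap : cut ℕ.+ (n ℕ.+ j) ≡ n ℕ.+ (cut ℕ.+ j)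
        swap = ≡.trans (≡.sym (ℕₚ.+-assoc cut n j)) (≡.trans (≡.cong (ℕ._+ j) (ℕₚ.+-comm cut n)) (ℕₚ.+-assoc n cut j))

      horizontal : ∀ j → D ≈ 0# → B (suc j) ≈ a j * B j
      horizontal j D≈0 = drift-horizontal D≈0 (drift j)

      φ′<φ+π : ∀ j → φ (suc j) < φ j + π
      φ′<φ+π j = less-than-half-turn (polar-F j) (polar-F (suc j)) λ D≈0 (0<B , B′<0) →
        ≤⇒≯ (proj₁ (*-pos (0<a j) 0<B)) (<-respˡ-≈ (horizontal j D≈0) B′<0)

      φ<φ′+π : ∀ j → φ j < φ (suc j) + π
      φ<φ′+π j = less-than-half-turn (polar-F (suc j)) (polar-F j) λ D≈0 (0<B′ , B<0) →
        ≤⇒≯ (proj₁ (*-posˡ-<0 (0<a j) B<0)) (<-respʳ-≈ (horizontal j D≈0) 0<B′)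

      sin-lift : ∀ j x → sin (t j - x) ≈ sin (ang j - x)
      sin-lift j = sin-turned ((cut ℕ.+ j) / n) (ang j)

      push₁ : ∀ j → PushedBack (sin (u j)) (B j) (B (suc j))
      push₁ j = let p , 0<p , e = cross-product (polar-f j) (polar-F j) in
        pushed 0<p (trans (drift j) (+-congˡ (trans e (-‿cong (*-congˡ (sym (sin-lift j (φ j))))))))

      -- With `d` the step of the intercept, `a * d` equals `d - (1 - a) * d`, which is the cross
      -- product with `B′` in place of `B`. Dividing by the positive slope `a` yields the rate
      -- `i * p`.
      push₂ : ∀ j → PushedBack (sin (v j)) (B j) (B (suc j))
      push₂ j = let p , 0<p , e = cross-product (polar-f j) (polar-F (suc j))
                    i , 0<i , ai≈1 = inverse-pos (0<a j) in
        pushed (*-pos 0<i 0<p) (begin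
          B′                                       ≈⟨ solve 2 (λ B B′ → B′ := B :+ (B′ :- B) :* con (+ 1)) refl (B j) B′ ⟩
          B j + d * 1#                             ≈⟨ +-congˡ (*-congˡ ai≈1) ⟨
          B j + d * (a j * i)                      ≈⟨ +-congˡ (solve 3 (λ a i d → d :* (a :* i) := i :* (d :- (con (+ 1) :- a) :* d)) refl (a j) i d) ⟩
          B j + i * (d - (1# - a j) * d)           ≈⟨ +-congˡ (*-congˡ (+-congʳ B′-B)) ⟩
          B j + i * ((b j * D - (1# - a j) * B j) - (1# - a j) * d)
            ≈⟨ +-congˡ (*-congˡ (solve 4 (λ x k B B′ → (x :- k :* B) :- k :* (B′ :- B) := x :- k :* B′) refl (b j * D) (1# - a j) (B j) B′)) ⟩
          B j + i * (b j * D - (1# - a j) * B′)    ≈⟨ +-congˡ (*-congˡ (trans e (-‿cong (*-congˡ (sym (sin-lift j (φ (suc j)))))))) ⟩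
          B j + i * - (p * sin (v j))              ≈⟨ solve 4 (λ B i p s → B :+ i :* (:- (p :* s)) := B :- (i :* p) :* s) refl (B j) i p (sin (v j)) ⟩
          B j - (i * p) * sin (v j)                ∎)
        where
        B′ = B (suc j)
        d = B′ - B j
        B′-B : B′ - B j ≈ b j * D - (1# - a j) * B j
        B′-B = trans (+-congʳ (drift j)) (solve 2 (λ B d → (B :+ d) :- B := d) refl (B j) _)

      frame : Frame n u v B
      frame = record
        { near₁   = λ j → <-by (φ<φ′+π j) (solve 4 (λ t x y p → (y :+ p) :- x := ((t :- x) :+ p) :- (t :- y)) refl (t j) (φ j) (φ (suc j)) π)
        ; near₂   = λ j → <-by (φ′<φ+π j) (solve 4 (λ t x y p → (x :+ p) :- y := ((t :- y) :+ p) :- (t :- x)) refl (t j) (φ j) (φ (suc j)) π)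
        ; step₁   = push₁
        ; step₂   = push₂
        ; advance = λ j → +-mono-≤ (- φ (suc j)) (t-mono j)
        ; turn    = λ j → trans (+-cong (+-cong (cyclicᵃ j) (turns-n j)) (-‿cong (cyclicᵠ j)))
                            (solve 4 (λ x p q y → (x :+ (p :+ q)) :- y := ((x :+ q) :- y) :+ p) refl (ang j) 2π (turns j) (φ j))
        ; closed  = cyclicᴮ
        }

      -- Undoing the turns counted at `i` makes the lifted angle there a plain difference of two
      -- polar angles, which lies in `(-2π, 2π)`.
      frame-at : ∀ i → Frame n (λ j → u j - turns i) (λ j → v j - turns i) B
      frame-at i = translate frame (- turns i) (sin-sub-×2π ((cut ℕ.+ i) / n))

      u-at : ∀ i → u i - turns i ≈ ang i - φ i
      u-at i = solve 3 (λ x q y → ((x :+ q) :- y) :- q := x :- y) refl (ang i) (turns i) (φ i)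

      -2π<d : ∀ i → - 2π < ang i - φ i
      -2π<d i = <-by (<-≤-add (proj₁ (proj₂ (polar-F i))) (proj₁ (polar-f i)))
        (solve 3 (λ x y p → (p :+ x) :- (y :+ con (+ 0)) := (x :- y) :- (:- p)) refl (ang i) (φ i) 2π)

      d<2π : ∀ i → ang i - φ i < 2π
      d<2π i = <-by (<-≤-add (proj₁ (proj₂ (polar-f i))) (proj₁ (polar-F i)))
        (solve 3 (λ x y p → (p :+ y) :- (x :+ con (+ 0)) := p :- (x :- y)) refl (ang i) (φ i) 2π)

      sin-d : ∀ i → sin (u i) ≈ sin (ang i - φ i)
      sin-d i = sin-lift i (φ i)

    FlatAtMaximum FlatAtMinimum : ℕ → Set ℓ
    FlatAtMaximum i = ang i - φ i ≈ 0# × (∀ {m} → m ℕ.≤ n → B (m ℕ.+ i) ≤ B i)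
    FlatAtMinimum i = (ang i - φ i ≈ π ⊎ ang i - φ i ≈ - π) × (∀ {m} → m ℕ.≤ n → B i ≤ B (m ℕ.+ i))

    flat-step : ∀ i → B (suc i) ≈ B i → FlatAtMaximum i ⊎ FlatAtMinimum i
    flat-step i B′≈B = cases (sin≈0⇒ (-2π<d i) (d<2π i) (trans (sym (sin-d i)) (flat (push₁ i) B′≈B)))
      where
      cases : ang i - φ i ≈ 0# ⊎ ang i - φ i ≈ π ⊎ ang i - φ i ≈ - π → FlatAtMaximum i ⊎ FlatAtMinimum i
      cases (inj₁ d≈0)         = inj₁ (d≈0 , peak (frame-at i) (trans (u-at i) d≈0))
      cases (inj₂ (inj₁ d≈π))  = inj₂ (inj₁ d≈π , trough (frame-at i) (- π) sin-sub-π
                                   (trans (+-congʳ (trans (u-at i) d≈π)) (-‿inverseʳ π)))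
      cases (inj₂ (inj₂ d≈-π)) = inj₂ (inj₂ d≈-π , trough (frame-at i) π sin-add-π
                                   (trans (+-congʳ (trans (u-at i) d≈-π)) (-‿inverseˡ π)))

    -- The step out of a minimum cannot fall, so the sine there is nonpositive; this places the
    -- angle, up to a full turn, in `[-π, 0]`.
    unimodal-from-minimum : ∀ i → (∀ m → B i ≤ B (m ℕ.+ i)) → UnimodalFrom n B i
    unimodal-from-minimum i min = cases
      (sin≤0⇒ (-2π<d i) (d<2π i) (≤-respˡ-≈ (sin-d i) (≮⇒≥ λ 0<s → ≤⇒≯ (min 1) (falls< (push₁ i) 0<s))))
      where
      cases : (- π ≤ ang i - φ i × ang i - φ i ≤ 0#) ⊎ (π ≤ ang i - φ i) → UnimodalFrom n B i
      cases (inj₁ (-π≤d , d≤0)) = ascent-then-descent (frame-at i)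
        (≤-respʳ-≈ (sym (u-at i)) -π≤d) (≤-respˡ-≈ (sym (u-at i)) d≤0) min
      -- One more turn back moves `[π, 2π)` to `[-π, 0)`.
      cases (inj₂ π≤d) = ascent-then-descent (translate (frame-at i) (- 2π) (sin-sub-×2π 1))
        (≤-respʳ-≈ (+-congʳ (sym (u-at i))) (≤-by π≤d (solve 2 (λ d p → d :- p := (d :- (p :+ p)) :- (:- p)) refl (ang i - φ i) π)))
        (≤-respˡ-≈ (+-congʳ (sym (u-at i))) (≤-by (proj₁ (d<2π i)) (solve 2 (λ d p → p :- d := con (+ 0) :- (d :- p)) refl (ang i - φ i) 2π)))
        min

-- Congruence of angles, and linear functions as vectors.

module Composites {c ℓ} (R : Reals c ℓ) (T : Trigonometry R) where
  open Lifting R T public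
  open LinearFunctions R T public
  open SetoidReasoning setoid

  cos-add-2π : ∀ x → cos (x + 2π) ≈ cos x
  cos-add-2π x = begin
    cos (x + 2π)       ≈⟨ cos-cong (+-assoc x π π) ⟨
    cos ((x + π) + π)  ≈⟨ cos-add-π (x + π) ⟩
    - cos (x + π)      ≈⟨ -‿cong (cos-add-π x) ⟩
    - - cos x          ≈⟨ -‿involutive _ ⟩
    cos x              ∎

  cos-·2π⁺ : ∀ m → cos ((+ m) · 2π) ≈ 1#
  cos-·2π⁺ zero    = cos-0
  cos-·2π⁺ (suc m) = trans (cos-cong (+-comm 2π _)) (trans (cos-add-2π _) (cos-·2π⁺ m))

  cos-·2π : ∀ m → cos (m · 2π) ≈ 1#
  cos-·2π (+ m)    = cos-·2π⁺ m
  cos-·2π -[1+ m ] = trans (cos-neg _) (cos-·2π⁺ (suc m))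

  -- Cosine is `1` at every multiple of `2π`. The two congruences would give `x - y` and
  -- `(x - y) + π` the same cosine `1`, although a half turn negates it.
  ¬both-0-and-π : ∀ {x y} → (x + π) ≈[2π] y → ¬ (x ≈[2π] y)
  ¬both-0-and-π {x} {y} (m , e) (m′ , e′) = ≤⇒≯ (proj₁ 0<1) (<-respˡ-≈ (sym 1≈-1) -1<0)
    where
    1≈-1 : 1# ≈ - 1#
    1≈-1 = begin
      1#                   ≈⟨ cos-·2π m ⟨
      cos (m · 2π)         ≈⟨ cos-cong e ⟨
      cos ((x + π) - y)    ≈⟨ cos-cong (solve 3 (λ x p y → (x :+ p) :- y := (x :- y) :+ p) refl x π y) ⟩
      cos ((x - y) + π)    ≈⟨ cos-add-π (x - y) ⟩
      - cos (x - y)        ≈⟨ -‿cong (trans (cos-cong e′) (cos-·2π m′)) ⟩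
      - 1#                 ∎
    -1<0 : - 1# < 0#
    -1<0 = <-by 0<1 (solve 1 (λ o → o :- con (+ 0) := con (+ 0) :- (:- o)) refl 1#)

  Nonzero : Linear → Set ℓ
  Nonzero f = ¬ (intercept f ≈ 0# × 1# - slope f ≈ 0#)

  θ-nonzero : ∀ f → Nonzero f → ∃[ t ] θ f ≡ just t × IsPolarAngle (intercept f) (1# - slope f) t
  θ-nonzero (a x+ b) f≉0 with (b ≟ 0#) ×-dec ((1# - a) ≟ 0#)
  ... | yes f≈0 = contradiction f≈0 f≉0
  ... | no  v≉0 = _ , ≡.refl , proj₂ (polar b (1# - a) v≉0)

  zero⇒identical : ∀ f → intercept f ≈ 0# → 1# - slope f ≈ 0# → Identical f
  zero⇒identical (a x+ b) b≈0 1-a≈0 x = begin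
    a * x + b               ≈⟨ solve 3 (λ a x b → a :* x :+ b := x :+ (b :- (con (+ 1) :- a) :* x)) refl a x b ⟩
    x + (b - (1# - a) * x)  ≈⟨ +-congˡ (+-cong b≈0 (-‿cong (*-congʳ 1-a≈0))) ⟩
    x + (0# - 0# * x)       ≈⟨ solve 1 (λ x → x :+ (con (+ 0) :- con (+ 0) :* x) := x) refl x ⟩
    x                       ∎

  ≈ᴸ⇒intercept : ∀ {f g} → f ≈ᴸ g → intercept f ≈ intercept g
  ≈ᴸ⇒intercept {a x+ b} {a′ x+ b′} f≈g = begin
    b             ≈⟨ solve 2 (λ a b → a :* con (+ 0) :+ b := b) refl a b ⟨
    a * 0# + b    ≈⟨ f≈g 0# ⟩
    a′ * 0# + b′  ≈⟨ solve 2 (λ a b → a :* con (+ 0) :+ b := b) refl a′ b′ ⟩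
    b′            ∎

  ≤ᴸ-intercept : ∀ {f g} → slope f ≈ slope g → intercept f ≤ intercept g → f ≤ᴸ g
  ≤ᴸ-intercept {a x+ b} {a′ x+ b′} a≈a′ b≤b′ x = ≤-add (≤-reflexive (*-congʳ a≈a′)) b≤b′

  argmin : ∀ (y : ℕ → Carrier) N → ∃[ i ] ∀ {j} → j ℕ.≤ N → y i ≤ y j
  argmin y zero    = zero , λ { ℕ.z≤n → ≤-refl }
  argmin y (suc N) with argmin y N
  ... | i , min with ≤-or-> (y i) (y (suc N))
  ...   | inj₁ yᵢ≤y = i , λ j≤1+N → cases (ℕₚ.m≤n⇒m<n∨m≡n j≤1+N)
    where
    cases : ∀ {j} → j ℕ.< suc N ⊎ j ≡ suc N → y i ≤ y j
    cases (inj₁ j<1+N)  = min (ℕ.s≤s⁻¹ j<1+N)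
    cases (inj₂ ≡.refl) = yᵢ≤y
  ...   | inj₂ y<yᵢ = suc N , λ j≤1+N → cases (ℕₚ.m≤n⇒m<n∨m≡n j≤1+N)
    where
    cases : ∀ {j} → j ℕ.< suc N ⊎ j ≡ suc N → y (suc N) ≤ y j
    cases (inj₁ j<1+N)  = ≤-trans (proj₁ y<yᵢ) (min (ℕ.s≤s⁻¹ j<1+N))
    cases (inj₂ ≡.refl) = ≤-refl

  -- Composites over windows of consecutive functions.

  module Segments (g : ℕ → Linear) where

    -- The accumulator `z` is applied innermost, as in `Vector.foldl`, so composites unfold to
    -- segments without reassociation. Positions are natural numbers, so that a window can slide
    -- past the end of the cycle.
    segment : Linear → ℕ → ℕ → Linear
    segment z j zero    = z
    segment z j (suc m) = segment (g j ∘ᴸ z) (suc j) m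

    foldl-segment : ∀ m {z} j (h : Fin m → Linear) → (∀ i → h i ≡ g (toℕ i ℕ.+ j)) →
                    Vector.foldl (λ f f′ → f′ ∘ᴸ f) z h ≡ segment z j m
    foldl-segment zero    j h h≡ = ≡.refl
    foldl-segment (suc m) {z} j h h≡ rewrite h≡ zero =
      foldl-segment m (suc j) (h ∘ suc) λ i → ≡.trans (h≡ (suc i)) (≡.cong g (≡.sym (ℕₚ.+-suc (toℕ i) j)))

    segment-last : ∀ z j m → segment z j (suc m) ≡ g (m ℕ.+ j) ∘ᴸ segment z j m
    segment-last z j zero    = ≡.refl
    segment-last z j (suc m) = ≡.trans (segment-last (g j ∘ᴸ z) (suc j) m)
      (≡.cong (λ k → g k ∘ᴸ segment (g j ∘ᴸ z) (suc j) m) (ℕₚ.+-suc m j))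

    -- `h` is chosen before `z`: the same `h` serves the window that starts with `g j` and the one
    -- that omits it, and so makes overlapping windows comparable.
    segment-factors : ∀ j m → ∃[ h ] ∀ z → slope (segment z j m) ≈ slope h * slope z
                                         × intercept (segment z j m) ≈ slope h * intercept z + intercept h
    segment-factors j zero    = idᴸ , λ z → sym (*-identityˡ _) , sym (trans (+-identityʳ _) (*-identityˡ _))
    segment-factors j (suc m) with segment-factors (suc j) m
    ... | h , e = h ∘ᴸ g j , λ z →
      trans (proj₁ (e _)) (sym (*-assoc _ _ _)) ,
      trans (proj₂ (e _)) (solve 5 (λ p q a b i → p :* (a :* i :+ b) :+ q := (p :* a) :* i :+ (p :* b :+ q))
        refl (slope h) (intercept h) (slope (g j)) (intercept (g j)) (intercept z))

    -- Moving the window by one position conjugates the composite by g j.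
    window-moves : ∀ j m → g (m ℕ.+ suc j) ≡ g j →
      let F  = segment idᴸ j (suc m)
          F′ = segment idᴸ (suc j) (suc m)
      in slope F′ ≈ slope F
       × intercept F′ ≈ intercept F + (intercept (g j) * (1# - slope F) - (1# - slope (g j)) * intercept F)
    window-moves j m g≡ with segment-factors (suc j) m
    ... | h , e = slopes , (begin
        intercept F′            ≈⟨ intercept-F′ ⟩
        -- `F` is `h` after `g j` and `F′` is `g j` after `h`, so the drift is a polynomial identity
        -- in the four coefficients.
        a * q + b               ≈⟨ solve 4 (λ a b p q → a :* q :+ b := (p :* b :+ q) :+
                                     (b :* (con (+ 1) :- p :* a) :- (con (+ 1) :- a) :* (p :* b :+ q))) refl a b p q ⟩
        (p * b + q) + (b * (1# - p * a) - (1# - a) * (p * b + q))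
                                ≈⟨ +-cong intercept-F (+-cong (*-congˡ (+-congˡ (-‿cong slope-F))) (-‿cong (*-congˡ intercept-F))) ⟨
        intercept F + (b * (1# - slope F) - (1# - a) * intercept F) ∎)
      where
      F  = segment idᴸ j (suc m)
      F′ = segment idᴸ (suc j) (suc m)
      a = slope (g j)
      b = intercept (g j)
      p = slope h
      q = intercept h
      F′≡ : F′ ≡ g j ∘ᴸ segment idᴸ (suc j) m
      F′≡ = ≡.trans (segment-last idᴸ (suc j) m) (≡.cong (_∘ᴸ segment idᴸ (suc j) m) g≡)
      slope-F : slope F ≈ p * a
      slope-F = trans (proj₁ (e (g j ∘ᴸ idᴸ))) (*-congˡ (*-identityʳ a))
      intercept-F : intercept F ≈ p * b + q
      intercept-F = trans (proj₂ (e (g j ∘ᴸ idᴸ)))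
        (+-congʳ (*-congˡ (trans (+-congʳ (zeroʳ a)) (+-identityˡ b))))
      slopes : slope F′ ≈ slope F
      slopes = begin
        slope F′                               ≡⟨ ≡.cong slope F′≡ ⟩
        a * slope (segment idᴸ (suc j) m)      ≈⟨ *-congˡ (trans (proj₁ (e idᴸ)) (*-identityʳ p)) ⟩
        a * p                                  ≈⟨ *-comm a p ⟩
        p * a                                  ≈⟨ slope-F ⟨
        slope F                                ∎
      intercept-F′ : intercept F′ ≈ a * q + b
      intercept-F′ = begin
        intercept F′                               ≡⟨ ≡.cong intercept F′≡ ⟩
        a * intercept (segment idᴸ (suc j) m) + b  ≈⟨ +-congʳ (*-congˡ (trans (proj₂ (e idᴸ)) (trans (+-congʳ (zeroʳ p)) (+-identityˡ q)))) ⟩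
        a * q + b                                  ∎

  -- The composites of the shifts of one permutation.

  module _ (n : ℕ) .{{_ : NonZero n}} (f : Fin n → Linear) (τ : Permutation′ n) where
    open Cyclic (shifts f τ)

    private
      g : ℕ → Linear
      g j = f (τ ⟨$⟩ʳ (j mod n))

    open Segments g

    at-cong : ∀ {i j} → i % n ≡ j % n → at i ≡ at j
    at-cong i≡j = ≡.cong (shifts f τ) (mod-cong-% i≡j)

    at-toℕ : ∀ k → at (toℕ k) ≡ shifts f τ k
    at-toℕ k = ≡.cong (shifts f τ) (mod-toℕ k)

    at-segment : ∀ j → at j ≡ segment idᴸ j n
    at-segment j = foldl-segment n j _ λ i → ≡.cong (λ p → f (τ ⟨$⟩ʳ p)) (mod-cong-%
      (≡.trans (%-congˡ (≡.cong (toℕ i ℕ.+_) (toℕ-fromℕ< (m%n<n j n)))) ([m+k%n]%n≡[m+k]%n (toℕ i) j)))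

    -- `PotentiallyIdentical` speaks of `τ` itself and not of its 0-shift, whose indices are reduced
    -- modulo `n`.
    whole-segment : f ^ (τ ⟨$⟩ʳ_) ≡ segment idᴸ 0 n
    whole-segment = foldl-segment n 0 _ λ i → ≡.cong (λ p → f (τ ⟨$⟩ʳ p))
      (≡.sym (≡.trans (≡.cong (_mod n) (ℕₚ.+-identityʳ (toℕ i))) (mod-toℕ i)))

    at-moves : ∀ j → slope (at (suc j)) ≈ slope (at j)
      × intercept (at (suc j)) ≈ intercept (at j)
          + (intercept (g j) * (1# - slope (at j)) - (1# - slope (g j)) * intercept (at j))
    at-moves j = ≡.subst₂ (λ F F′ → slope F′ ≈ slope F
      × intercept F′ ≈ intercept F + (intercept (g j) * (1# - slope F) - (1# - slope (g j)) * intercept F))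
      (window j) (window (suc j))
      (window-moves j (ℕ.pred n) (≡.cong (λ p → f (τ ⟨$⟩ʳ p)) (mod-cong-% (≡.trans (%-congˡ n-further) ([n+m]%n≡m%n j)))))
      where
      window : ∀ j → segment idᴸ j (suc (ℕ.pred n)) ≡ at j
      window j = ≡.trans (≡.cong (segment idᴸ j) (ℕₚ.suc-pred n)) (≡.sym (at-segment j))
      n-further : ℕ.pred n ℕ.+ suc j ≡ n ℕ.+ j
      n-further = ≡.trans (ℕₚ.+-suc (ℕ.pred n) j) (≡.cong (ℕ._+ j) (ℕₚ.suc-pred n))

    private
      B : ℕ → Carrier
      B j = intercept (at j)

      D : Carrier
      D = 1# - slope (at 0)

    slope-at : ∀ j → slope (at j) ≈ slope (at 0)
    slope-at zero    = refl
    slope-at (suc j) = trans (proj₁ (at-moves j)) (slope-at j)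

    slope-at₂ : ∀ i j → slope (at i) ≈ slope (at j)
    slope-at₂ i j = trans (slope-at i) (sym (slope-at j))

    ≤ᴸ-at : ∀ {i j} → B i ≤ B j → at i ≤ᴸ at j
    ≤ᴸ-at {i} {j} = ≤ᴸ-intercept (slope-at₂ i j)

    within-one-turn : ∀ j i → ∃[ m ] m ℕ.≤ n × at (m ℕ.+ j) ≡ shifts f τ i
    within-one-turn j i = m , m%n≤n _ n , ≡.trans (at-cong reaches) (at-toℕ i)
      where
      -- The forward cyclic distance from `j` to `i`; adding the complement of `j % n` avoids a
      -- truncated difference.
      m = (toℕ i ℕ.+ (n ℕ.∸ j % n)) % n
      reaches : (m ℕ.+ j) % n ≡ toℕ i % n
      reaches = ≡R.begin
        (m ℕ.+ j) % n                                      ≡R.≡⟨ %-congˡ (ℕₚ.+-comm m j) ⟩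
        (j ℕ.+ m) % n                                      ≡R.≡⟨ [m+k%n]%n≡[m+k]%n j _ ⟩
        (j ℕ.+ (toℕ i ℕ.+ (n ℕ.∸ j % n))) % n              ≡R.≡⟨ %-congˡ (ℕₚ.+-comm j _) ⟩
        (toℕ i ℕ.+ (n ℕ.∸ j % n) ℕ.+ j) % n                ≡R.≡⟨ [m+k%n]%n≡[m+k]%n _ j ⟨
        (toℕ i ℕ.+ (n ℕ.∸ j % n) ℕ.+ j % n) % n            ≡R.≡⟨ %-congˡ (ℕₚ.+-assoc (toℕ i) _ _) ⟩
        (toℕ i ℕ.+ ((n ℕ.∸ j % n) ℕ.+ j % n)) % n          ≡R.≡⟨ %-congˡ (≡.cong (toℕ i ℕ.+_) (ℕₚ.m∸n+n≡m (m%n≤n j n))) ⟩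
        (toℕ i ℕ.+ n) % n                                  ≡R.≡⟨ [m+n]%n≡m%n (toℕ i) n ⟩
        toℕ i % n                                          ≡R.∎
        where module ≡R = ≡.≡-Reasoning

    maximum-at : ∀ j → (∀ {m} → m ℕ.≤ n → B (m ℕ.+ j) ≤ B j) → IsMaximum (at j)
    maximum-at j max = (j mod n , λ _ → refl) , λ i →
      let m , m≤n , e = within-one-turn j i in ≡.subst (_≤ᴸ at j) e (≤ᴸ-at (max m≤n))

    minimum-at : ∀ j → (∀ {m} → m ℕ.≤ n → B j ≤ B (m ℕ.+ j)) → IsMinimum (at j)
    minimum-at j min = (j mod n , λ _ → refl) , λ i →
      let m , m≤n , e = within-one-turn j i in ≡.subst (at j ≤ᴸ_) e (≤ᴸ-at (min m≤n))

    maximum-resp-≈ : ∀ {F F′} → F ≈ᴸ F′ → IsMaximum F → IsMaximum F′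
    maximum-resp-≈ F≈F′ ((i , F≈) , max) = (i , λ x → trans (sym (F≈F′ x)) (F≈ x)) , λ j x → ≤-respʳ-≈ (F≈F′ x) (max j x)

    minimum-resp-≈ : ∀ {F F′} → F ≈ᴸ F′ → IsMinimum F → IsMinimum F′
    minimum-resp-≈ F≈F′ ((i , F≈) , min) = (i , λ x → trans (sym (F≈F′ x)) (F≈ x)) , λ j x → ≤-respˡ-≈ (F≈F′ x) (min j x)

    unimodal-at : ∀ i → UnimodalFrom n B i → Unimodal
    unimodal-at i (l , l≤n , up , down) = i , l ℕ.+ i , ℕₚ.m≤n+m i l ,
      ℕₚ.≤-trans (ℕₚ.+-monoˡ-≤ i l≤n) (ℕₚ.≤-reflexive (ℕₚ.+-comm n i)) ,
      (λ j i≤j j<l+i → let e = ℕₚ.m∸n+n≡m i≤j in ≤ᴸ-at (≡.subst (λ k → B k ≤ B (suc k)) e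
        (up (ℕₚ.+-cancelʳ-< i _ _ (≡.subst (ℕ._< l ℕ.+ i) (≡.sym e) j<l+i))))) ,
      (λ j l+i≤j j<i+n → let e = ℕₚ.m∸n+n≡m (ℕₚ.≤-trans (ℕₚ.m≤n+m i l) l+i≤j) in
        ≤ᴸ-at (≡.subst (λ k → B (suc k) ≤ B k) e
        (down (ℕₚ.+-cancelʳ-≤ i _ _ (≡.subst (l ℕ.+ i ℕ.≤_) (≡.sym e) l+i≤j))
              (ℕₚ.+-cancelʳ-< i _ _ (≡.subst₂ ℕ._<_ (≡.sym e) (ℕₚ.+-comm i n) j<i+n)))))

    private
      -- The composite at `j` is the identity. `D` is taken at position `0` because all composites
      -- have the same slope.
      DegenerateAt : ℕ → Set ℓ
      DegenerateAt j = B j ≈ 0# × D ≈ 0#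

      horizontal : ∀ j → D ≈ 0# → B (suc j) ≈ slope (g j) * B j
      horizontal j D≈0 = drift-horizontal (trans (+-congˡ (-‿cong (slope-at j))) D≈0) (proj₂ (at-moves j))

      degenerate-forward : ∀ j → DegenerateAt 0 → DegenerateAt j
      degenerate-forward zero    d = d
      degenerate-forward (suc j) d with degenerate-forward j d
      ... | B≈0 , D≈0 = trans (horizontal j D≈0) (trans (*-congˡ B≈0) (zeroʳ _)) , D≈0

    module _ (d : DegenerateAt 0) where

      private
        B-const : ∀ i j → B i ≤ B j
        B-const i j = ≤-reflexive (trans (proj₁ (degenerate-forward i d)) (sym (proj₁ (degenerate-forward j d))))

      strictly-unimodal-degenerate : StrictlyUnimodal
      strictly-unimodal-degenerate =
        -- All intercepts agree, so the peak can be put at the start and every tie counted as a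
        -- maximum.
        unimodal-at 0 (0 , ℕ.z≤n , (λ ()) , λ _ _ → B-const _ _) ,
        λ j _ → inj₂ (≡.subst IsMaximum (at-toℕ j) (maximum-at (toℕ j) λ _ → B-const _ _))

      identical-degenerate : Identical (f ^ (τ ⟨$⟩ʳ_))
      identical-degenerate = ≡.subst Identical (≡.trans (at-segment 0) (≡.sym whole-segment))
        (zero⇒identical (at 0) (proj₁ d) (proj₂ d))

    module _ (monotone : ∀ i → Monotone (f i)) (non-identical : ∀ i → ¬ Identical (f i))
             (counterclockwise : Counterclockwise f τ) (¬d : ¬ DegenerateAt 0) where

      private
        -- At slope `1` each step multiplies the intercept by the positive slope of `g j`, so a
        -- vanishing intercept also propagates backwards.
        degenerate-backward : ∀ j → DegenerateAt j → DegenerateAt 0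
        degenerate-backward zero    e = e
        degenerate-backward (suc j) (B≈0 , D≈0) = degenerate-backward j
          (*-cancelˡ-0 (0<⇒≉0 (monotone _)) (trans (sym (horizontal j D≈0)) B≈0) , D≈0)

        nonzero-f : ∀ i → Nonzero (f i)
        nonzero-f i (b≈0 , 1-a≈0) = non-identical i (zero⇒identical (f i) b≈0 1-a≈0)

        nonzero-at : ∀ j → Nonzero (at j)
        nonzero-at j (B≈0 , e) = ¬d (degenerate-backward j (B≈0 , trans (+-congˡ (-‿cong (sym (slope-at j)))) e))

        angle : Fin n → Carrier
        angle i = proj₁ (θ-nonzero (f (τ ⟨$⟩ʳ i)) (nonzero-f (τ ⟨$⟩ʳ i)))

        θ-f : ∀ i → θ (f (τ ⟨$⟩ʳ i)) ≡ just (angle i)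
        θ-f i = proj₁ (proj₂ (θ-nonzero (f (τ ⟨$⟩ʳ i)) (nonzero-f (τ ⟨$⟩ʳ i))))

        φ : ℕ → Carrier
        φ j = proj₁ (θ-nonzero (at j) (nonzero-at j))

        θ-at : ∀ j → θ (at j) ≡ just (φ j)
        θ-at j = proj₁ (proj₂ (θ-nonzero (at j) (nonzero-at j)))

        angles≡ : angles f τ ≡ tabulate angle
        angles≡ = ≡.trans (mapMaybe-total θ-f _) (Listₚ.map-tabulate id angle)

        rotation : ∃[ s ] ∀ j → suc ((s ℕ.+ j) % n) ℕ.< n → angle (j mod n) ≤ angle (suc j mod n)
        rotation = linked-rotate angle (proj₁ counterclockwise)
          (≡.subst (λ L → Linked _≤_ (drop (proj₁ counterclockwise) L ++ take (proj₁ counterclockwise) L))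
            angles≡ (proj₂ counterclockwise))

        polar-at : ∀ j → IsPolarAngle (B j) D (φ j)
        polar-at j = let 0≤φ , φ<2π , r , 0<r , X≈ , Y≈ = proj₂ (proj₂ (θ-nonzero (at j) (nonzero-at j))) in
          0≤φ , φ<2π , r , 0<r , X≈ , trans (+-congˡ (-‿cong (sym (slope-at j)))) Y≈

        cyclicDrift : CyclicDrift n (λ j → slope (g j)) (λ j → intercept (g j)) B (λ j → angle (j mod n)) φ D
        cyclicDrift = record
          { 0<a     = λ j → monotone _
          ; drift   = λ j → trans (proj₂ (at-moves j)) (+-congˡ (+-congʳ (*-congˡ (+-congˡ (-‿cong (slope-at j))))))
          ; polar-f = λ j → proj₂ (proj₂ (θ-nonzero (g j) (nonzero-f _)))
          ; polar-F = polar-at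
          ; cyclicᵃ = λ j → reflexive (≡.cong angle (mod-cong-% ([n+m]%n≡m%n j)))
          -- `φ` is defined through a proof that the vector is nonzero; its periodicity is therefore
          -- read off from `θ`, which depends on the composite alone.
          ; cyclicᵠ = λ j → reflexive (just-injective (≡.trans (≡.sym (θ-at (n ℕ.+ j)))
                        (≡.trans (≡.cong θ (at-cong ([n+m]%n≡m%n j))) (θ-at j))))
          ; cyclicᴮ = λ j → reflexive (≡.cong intercept (at-cong ([n+m]%n≡m%n j)))
          ; cut     = proj₁ rotation
          ; sorted  = proj₂ rotation
          }

        flat-at : ∀ k → shifts f τ k ≈ᴸ at (suc (toℕ k)) →
                  FlatAtMaximum cyclicDrift (toℕ k) ⊎ FlatAtMinimum cyclicDrift (toℕ k)
        flat-at k e = flat-step cyclicDrift (toℕ k)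
          (sym (trans (reflexive (≡.cong intercept (at-toℕ k))) (≈ᴸ⇒intercept e)))

        maximum : ∀ k → FlatAtMaximum cyclicDrift (toℕ k) → IsMaximum (shifts f τ k)
        maximum k (_ , max) = ≡.subst IsMaximum (at-toℕ k) (maximum-at (toℕ k) max)

        minimum : ∀ k → FlatAtMinimum cyclicDrift (toℕ k) → IsMinimum (shifts f τ k)
        minimum k (_ , min) = ≡.subst IsMinimum (at-toℕ k) (minimum-at (toℕ k) min)

        θ-shift : ∀ k → θ (shifts f τ k) ≡ just (φ (toℕ k))
        θ-shift k = ≡.trans (≡.cong θ (≡.sym (at-toℕ k))) (θ-at (toℕ k))

        angle-toℕ : ∀ k → angle (toℕ k mod n) ≡ angle k
        angle-toℕ k = ≡.cong angle (mod-toℕ k)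

        same-direction : ∀ k → FlatAtMaximum cyclicDrift (toℕ k) →
                         θ (f (τ ⟨$⟩ʳ k)) =[2π] θ (shifts f τ k)
        same-direction k (d≈0 , _) = ≡.subst₂ _=[2π]_ (≡.sym (θ-f k)) (≡.sym (θ-shift k))
          (just (+ 0 , ≡.subst (λ t → t - φ (toℕ k) ≈ 0#) (angle-toℕ k) d≈0))

        opposite-direction : ∀ k → FlatAtMinimum cyclicDrift (toℕ k) →
                             (θ (f (τ ⟨$⟩ʳ k)) +π) =[2π] θ (shifts f τ k)
        opposite-direction k (d , _) = ≡.subst₂ _=[2π]_ (≡.sym (≡.cong _+π (θ-f k))) (≡.sym (θ-shift k))
          (just (≡.subst (λ t → (t + π) ≈[2π] φ (toℕ k)) (angle-toℕ k) (turned d)))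
          where
          turned : ∀ {t s} → t - s ≈ π ⊎ t - s ≈ - π → (t + π) ≈[2π] s
          -- A difference of `π` grows to one full turn, hence the integer `1`; a difference of `-π`
          -- is cancelled, hence `0`.
          turned {t} {s} (inj₁ e) = + 1 , trans (solve 3 (λ t p s → (t :+ p) :- s := (t :- s) :+ p) refl t π s)
            (trans (+-congʳ e) (sym (+-identityʳ 2π)))
          turned {t} {s} (inj₂ e) = + 0 , trans (solve 3 (λ t p s → (t :+ p) :- s := (t :- s) :+ p) refl t π s)
            (trans (+-congʳ e) (-‿inverseˡ π))

      strictly-unimodal : StrictlyUnimodal
      strictly-unimodal = unimodal-at (proj₁ lowest) (unimodal-from-minimum cyclicDrift (proj₁ lowest) everywhere) ,
        λ j e → cases j (flat-at j e)
        where
        lowest : ∃[ i ] ∀ {j} → j ℕ.≤ n → B i ≤ B j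
        lowest = argmin B n
        everywhere : ∀ m → B (proj₁ lowest) ≤ B (m ℕ.+ proj₁ lowest)
        everywhere m = ≤-respʳ-≈ (reflexive (≡.cong intercept (at-cong (m%n%n≡m%n (m ℕ.+ proj₁ lowest) n))))
          (proj₂ lowest (m%n≤n (m ℕ.+ proj₁ lowest) n))
        cases : ∀ j → FlatAtMaximum cyclicDrift (toℕ j) ⊎ FlatAtMinimum cyclicDrift (toℕ j) →
                IsMinimum (shifts f τ j) ⊎ IsMaximum (shifts f τ j)
        cases j (inj₁ max) = inj₂ (maximum j max)
        cases j (inj₂ min) = inj₁ (minimum j min)

      TieAtMinimum TieAtMaximum : Fin n → Set (c Level.⊔ ℓ)
      TieAtMinimum k = IsMinimum (shifts f τ k) × IsMinimum (at (suc (toℕ k))) × (θ (f (τ ⟨$⟩ʳ k)) +π) =[2π] θ (shifts f τ k)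
      TieAtMaximum k = IsMaximum (shifts f τ k) × IsMaximum (at (suc (toℕ k))) × θ (f (τ ⟨$⟩ʳ k)) =[2π] θ (shifts f τ k)

      -- Exclusiveness comes from the angles: the direction of one function cannot be both equal and
      -- opposite to that of the composite.
      tie : ∀ k → shifts f τ k ≈ᴸ at (suc (toℕ k)) →
            (TieAtMinimum k ⊎ TieAtMaximum k) × ¬ (TieAtMinimum k × TieAtMaximum k)
      tie k e = cases (flat-at k e) , λ ((_ , _ , opposite) , (_ , _ , same)) →
          exclusive (≡.subst₂ _=[2π]_ (≡.cong _+π (θ-f k)) (θ-shift k) opposite)
                    (≡.subst₂ _=[2π]_ (θ-f k) (θ-shift k) same)
        where
        cases : FlatAtMaximum cyclicDrift (toℕ k) ⊎ FlatAtMinimum cyclicDrift (toℕ k) → TieAtMinimum k ⊎ TieAtMaximum k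
        cases (inj₁ max) = inj₂ (maximum k max , maximum-resp-≈ e (maximum k max) , same-direction k max)
        cases (inj₂ min) = inj₁ (minimum k min , minimum-resp-≈ e (minimum k min) , opposite-direction k min)
        exclusive : ∀ {t s} → just (t + π) =[2π] just s → ¬ (just t =[2π] just s)
        exclusive (just opposite) (just same) = ¬both-0-and-π opposite same

mainTheorem13 : ∀ {c ℓ} (R : Reals c ℓ) (T : Trigonometry R) →
    let open LinearFunctions R T in
    ∀ (n : ℕ) .{{_ : NonZero n}} (f : Fin n → Linear) →
    (∀ i → Monotone (f i)) →
    (∀ i → ¬ Identical (f i)) →
    (τ : Permutation′ n) → Counterclockwise f τ →
    let open Cyclic (shifts f τ) in
    StrictlyUnimodal ×
    (¬ Colinear f → ¬ PotentiallyIdentical f →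
      ∀ (k : Fin n) →
      let fτₖ   = shifts f τ k
          fτₖ₊₁ = at (suc (toℕ k))
          caseᵢ  = IsMinimum fτₖ × IsMinimum fτₖ₊₁ × (θ (f (τ ⟨$⟩ʳ k)) +π) =[2π] θ fτₖ
          caseᵢᵢ = IsMaximum fτₖ × IsMaximum fτₖ₊₁ × θ (f (τ ⟨$⟩ʳ k)) =[2π] θ fτₖ
      in fτₖ ≈ᴸ fτₖ₊₁ → (caseᵢ ⊎ caseᵢᵢ) × ¬ (caseᵢ × caseᵢᵢ))
mainTheorem13 R T n f monotone non-identical τ ccw =
  cases ((intercept F₀ ≟ 0#) ×-dec ((1# - slope F₀) ≟ 0#))
  where
  open Composites R T
  open Cyclic (shifts f τ)
  F₀ = at 0
  cases : Dec (intercept F₀ ≈ 0# × 1# - slope F₀ ≈ 0#) → _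
  cases (yes d) = strictly-unimodal-degenerate n f τ d ,
    λ _ ¬potentially-identical → contradiction (τ , ccw , identical-degenerate n f τ d) ¬potentially-identical
  cases (no ¬d) = strictly-unimodal n f τ monotone non-identical ccw ¬d ,
    λ _ _ → tie n f τ monotone non-identical ccw ¬d
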